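{- Every strongly connected digraph on $n$ vertices has cop number at most $O\big(n\cdot\frac{(\log\log n)^2}{\log n}\big)$. That is, there exist absolute constants $M>0$ and $n_0$ such that for every $n\ge n_0$ and every strongly connected digraph $D$ on $n$ vertices, $c(D)\le M\, n\,\frac{(\log\log n)^2}{\log n}$.
   Context: Digraphs are finite. Logarithms are natural. A digraph is strongly connected if there is a directed path from any vertex to any other vertex. Cops and Robbers on a digraph $D$: a perfect information game between a set of cops and one robber. First the cops are placed on vertices of their choice (several cops may share a vertex); then the robber, knowing the cops' placement, chooses a vertex. Then the cops and the robber move in alternate rounds, the cops moving first. In a cops' move each cop stays put or moves along one directed edge (respecting its direction); in the robber's move he stays put or moves along one directed edge (respecting its direction). The cops win if eventually a cop steps onto the vertex currently occupied by the robber; the robber wins if he can elude the cops indefinitely. The cop number $c(D)$ is the minimum number of cops that have a winning strategy on $D$. -}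

module Defs where

open import Level using (0ℓ)
open import Data.Nat using (ℕ; zero; suc)
import Data.Nat as ℕ
open import Data.Integer using (+_)
open import Data.Rational using (ℚ; 0ℚ; 1ℚ; _<_; _/_; +-*-rawSemiring)
import Data.Rational as ℚ
open import Algebra.Definitions.RawSemiring +-*-rawSemiring using () renaming (_^_ to _^ℚ_)
open import Data.Fin using (Fin)
open import Data.List using (List; []; _∷_)
open import Data.Product using (_×_; ∃-syntax)
open import Data.Vec.Functional using (Vector)
open import Relation.Binary using (Rel; Decidable)
open import Relation.Binary.Construct.Closure.Reflexive using (ReflClosure)
open import Relation.Binary.Construct.Closure.ReflexiveTransitive using (Star)
open import Relation.Binary.PropositionalEquality using (_≡_)

------------------------------------------------------------------------
-- Digraphs

-- Loops are permitted; they do not matter, since staying put is always a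
-- legal move.
record Digraph (n : ℕ) : Set₁ where
  field
    _⟶_  : Rel (Fin n) 0ℓ
    _⟶?_ : Decidable _⟶_

StronglyConnected : ∀ {n} → Digraph n → Set
StronglyConnected D = ∀ u v → Star (Digraph._⟶_ D) u v

------------------------------------------------------------------------
-- Cops and Robbers

module _ {n : ℕ} (D : Digraph n) where

  Move : Rel (Fin n) 0ℓ
  Move = ReflClosure (Digraph._⟶_ D)

  -- A strategy for k cops.  A history lists the robber's positions so far,
  -- most recent first.  cops [] is the initial placement, and cops (r ∷ h) is
  -- where the cops stand after the move they make when the robber, having
  -- followed h, is at r.  The cops' own past positions are determined by the
  -- strategy, so they need not be recorded in the history.
  record Strategy (k : ℕ) : Set where
    field
      cops  : List (Fin n) → Vector (Fin n) k
      legal : ∀ r h i → Move (cops h i) (cops (r ∷ h) i)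

  -- ρ 0 is the vertex chosen at the start, ρ (suc t) the position after the
  -- robber's (t + 1)-st move.
  record RobberPlay : Set where
    field
      ρ     : ℕ → Fin n
      legal : ∀ t → Move (ρ t) (ρ (suc t))

  history : (ℕ → Fin n) → ℕ → List (Fin n)
  history ρ zero    = ρ zero ∷ []
  history ρ (suc t) = ρ (suc t) ∷ history ρ t

  -- In the cops' (t + 1)-st move some cop reaches (or stays on) the vertex
  -- where the robber currently is.
  CaughtAt : ∀ {k} → Strategy k → RobberPlay → ℕ → Set
  CaughtAt σ R t = ∃[ i ] Strategy.cops σ (history ρ t) i ≡ ρ t
    where open RobberPlay R

  Winning : ∀ {k} → Strategy k → Set
  Winning σ = ∀ R → ∃[ t ] CaughtAt σ R t

  CopsWin : ℕ → Set
  CopsWin k = ∃[ σ ] Winning {k} σ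

  IsCopNumber : ℕ → Set
  IsCopNumber c = CopsWin c × (∀ k → CopsWin k → c ℕ.≤ k)

------------------------------------------------------------------------
-- Real numbers as cuts

-- A real x is given by the rationals below it and the rationals above it.
-- The Dedekind axioms are not part of the record, so Cut also has
-- elements that are not reals; it is only applied to the specific numbers
-- built below, and never quantified over.
record Cut : Set₁ where
  field
    Below Above : ℚ → Set

open Cut

infix  4 _≤ᶜ_
infixl 7 _*ᶜ_ _÷ᶜ_
infixr 8 _^ᶜ_
infix  9 _⁻¹ᶜ

_≤ᶜ_ : Cut → Cut → Set
x ≤ᶜ y = ∀ q → Below x q → Below y q

fromℚ : ℚ → Cut
fromℚ p .Below q = q < p
fromℚ p .Above q = p < q

fromℕ : ℕ → Cut
fromℕ n = fromℚ (+ n / 1)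

-- Interval multiplication: if a < x < b and c < y < d then x y lies between
-- the least and the greatest of a c, a d, b c, b d.
_*ᶜ_ : Cut → Cut → Cut
(x *ᶜ y) .Below q = ∃[ a ] ∃[ b ] ∃[ c ] ∃[ d ]
  (Below x a × Above x b × Below y c × Above y d) ×
  (q < a ℚ.* c × q < a ℚ.* d × q < b ℚ.* c × q < b ℚ.* d)
(x *ᶜ y) .Above q = ∃[ a ] ∃[ b ] ∃[ c ] ∃[ d ]
  (Below x a × Above x b × Below y c × Above y d) ×
  (a ℚ.* c < q × a ℚ.* d < q × b ℚ.* c < q × b ℚ.* d < q)

_^ᶜ_ : Cut → ℕ → Cut
x ^ᶜ zero  = fromℕ 1
x ^ᶜ suc m = x *ᶜ x ^ᶜ m

-- Meaningful for x > 0 only.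
_⁻¹ᶜ : Cut → Cut
(x ⁻¹ᶜ) .Below q = ∃[ u ] Above x u × q ℚ.* u < 1ℚ
(x ⁻¹ᶜ) .Above q = ∃[ l ] 0ℚ < l × Below x l × 1ℚ < q ℚ.* l

_÷ᶜ_ : Cut → Cut → Cut
x ÷ᶜ y = x *ᶜ y ⁻¹ᶜ

-- The limit of a convergent sequence.
lim : (ℕ → ℚ) → Cut
lim s .Below q = ∃[ r ] q < r × (∃[ N ] ∀ m → N ℕ.≤ m → r ℚ.≤ s m)
lim s .Above q = ∃[ r ] r < q × (∃[ N ] ∀ m → N ℕ.≤ m → s m ℚ.≤ r)

-- e^q = lim (1 + q/m)^m, shifted by one to avoid m = 0.
exp : ℚ → Cut
exp q = lim (λ m → (1ℚ ℚ.+ q ℚ.* (+ 1 / suc m)) ^ℚ suc m)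

-- The natural logarithm of x > 0: q < log x iff e^q < x, and log x < q iff
-- x < e^q.  A strict inequality between reals is witnessed by a rational u
-- separating them.
log : Cut → Cut
log x .Below q = ∃[ u ] Above (exp q) u × Below x u
log x .Above q = ∃[ u ] Above x u × Below (exp q) u

{-# OPTIONS --safe #-}
module Submission where

-- Park cops on a set G and keep the robber in a territory T that he cannot
-- leave without stepping next to a parked cop.  T is shrunk at the cost of at
-- most |R|/K parked cops per removed set R: a vertex with more than K
-- out-neighbours in T protects all of them; and if the in-ball of radius t
-- around a small set A has fewer than X|A| vertices, where X ≤ (1 + 1/K)^t,
-- some smaller in-ball has a boundary of at most a 1/K fraction, which is
-- parked on while spare cops flood the inside.  When neither applies, the
-- robber has at most K^t places after t moves, while every set of them has an
-- in-ball of radius t larger by the factor X.  Hence each place can be given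
-- a private set of X/2 vertices within distance t, and a greedy hitting set
-- of all private sets places cops that meet the robber after t moves.  With
-- X a power of log n and K of order log n / (log log n)², we have K^t ≤ √n,
-- and O(n/K) cops suffice.

open import Defs
open import Data.Nat using (ℕ; suc)

-- The square of log log n has two sources. Expansion by a power of log n at rate 1 + 1/K takes t of
-- order K log log n moves, and K^t ≤ √n asks for t log K ≤ (log n)/2, where log K can again be of
-- order log log n. Manning the hitting set takes unboundedly long, so it must be fixed before it is
-- known where the robber will be when the ambush starts. It therefore hits the private sets of all
-- starting vertices at once, at most n K^t sets, for a factor logarithmic in their number. Private
-- sets are found greedily rather than by Hall's theorem: one pass serves at least half of the
-- places, and every pass gets its own crew of cops. The private sets are large enough to absorb
-- this further logarithmic factor. Strong connectivity lets cops move anywhere, however slowly,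
-- while the parked ones confine the robber. Constructively, a least winning number of cops exists
-- only once `CopsWin D k` is decided, although strategies and plays are infinite objects. For this
-- the game is solved by backward induction on finitely many positions.

-- Backward induction for finite pursuit games

module FiniteGame where
  open import Data.Nat using (ℕ; zero; suc; _≤_; _^_; _*_; s≤s; z≤n)
  open import Data.Nat.Properties using (≤-trans; <⇒≱)
  open import Data.Fin using (Fin; combine; remQuot; finToFun; funToFin)
  open import Data.Fin.Properties using (any?; all?; _≟_; remQuot-combine; finToFun-funToFin)
  open import Data.Fin.Subset using (Subset; _∈_; _⊆_; ∣_∣)
  open import Data.Fin.Subset.Properties using (_⊆?_; _∈?_; p⊂q⇒∣p∣<∣q∣; ∣p∣≤n)
  open import Data.List using (List; []; _∷_)
  open import Data.Product using (_×_; _,_; proj₁; proj₂; ∃-syntax; Σ)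
  open import Data.Sum using (_⊎_; inj₁; inj₂)
  open import Data.Unit using (⊤; tt)
  open import Data.Empty using (⊥; ⊥-elim)
  open import Data.Bool using (true)
  open import Data.Vec using (tabulate)
  open import Data.Vec.Properties using (lookup∘tabulate; lookup⇒[]=; []=⇒lookup)
  open import Function using (id)
  open import Relation.Nullary using (Dec; yes; no; ¬_; does)
  open import Relation.Nullary.Decidable using (map′; _×-dec_; _⊎-dec_; _→-dec_; ¬?; decidable-stable)
  open import Relation.Unary using (Decidable)
  import Relation.Binary.Construct.Closure.Reflexive as Refl
  import Relation.Binary.Construct.Closure.Reflexive.Properties as Reflₚ
  open import Relation.Binary.PropositionalEquality using (_≡_; refl; sym; trans; cong; subst; subst₂)

  -- An inductive tree: every branch ends in a capture, with no common time bound stored. `Pos` is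
  -- abstract so that encoded vectors and lists of cops share the notion.
  data Win {Pos Rob : Set} (Legal : Pos → Pos → Set) (Caught : Pos → Rob → Set)
           (Flee : Rob → Rob → Set) (p : Pos) (r : Rob) : Set where
    step : ∀ p′ → Legal p p′ →
           Caught p′ r ⊎ (∀ r′ → Flee r r′ → Win Legal Caught Flee p′ r′) →
           Win Legal Caught Flee p r

  ⟦_⟧ : ∀ {n} {P : Fin n → Set} → Decidable P → Subset n
  ⟦ P? ⟧ = tabulate λ x → does (P? x)

  ∈⟦⟧⁺ : ∀ {n} {P : Fin n → Set} (P? : Decidable P) {x} → P x → x ∈ ⟦ P? ⟧
  ∈⟦⟧⁺ P? {x} px = lookup⇒[]= x ⟦ P? ⟧ (trans (lookup∘tabulate _ x) eq)
    where
    eq : does (P? x) ≡ true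
    eq with P? x
    ... | yes _ = refl
    ... | no ¬p = ⊥-elim (¬p px)

  ∈⟦⟧⁻ : ∀ {n} {P : Fin n → Set} (P? : Decidable P) {x} → x ∈ ⟦ P? ⟧ → P x
  ∈⟦⟧⁻ P? {x} x∈ = go (trans (sym (lookup∘tabulate _ x)) ([]=⇒lookup x∈))
    where
    go : does (P? x) ≡ true → _
    go eq with P? x
    ... | yes p = p
    go () | no _

  -- A strict inclusion raises the cardinality, which never exceeds `N`; so one of the first `N + 1`
  -- inclusions is an equality.
  stabilises : ∀ {N} (S : ℕ → Subset N) → (∀ j → S j ⊆ S (suc j)) → ∃[ j ] S (suc j) ⊆ S j
  stabilises {N} S inc with grow (suc N)
    where
    grow : ∀ m → (∃[ j ] S (suc j) ⊆ S j) ⊎ m ≤ ∣ S m ∣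
    grow zero = inj₂ z≤n
    grow (suc m) with grow m
    ... | inj₁ found = inj₁ found
    ... | inj₂ m≤ with S (suc m) ⊆? S m
    ...   | yes sub = inj₁ (m , sub)
    ...   | no ¬sub with any? (λ x → (x ∈? S (suc m)) ×-dec ¬? (x ∈? S m))
    ...     | yes (x , x∈ , x∉) = inj₂ (≤-trans (s≤s m≤) (p⊂q⇒∣p∣<∣q∣ (inc m , x , x∈ , x∉)))
    ...     | no none = ⊥-elim (¬sub λ {x} x∈ →
                decidable-stable (x ∈? S m) λ x∉ → none (x , x∈ , x∉))
  ... | inj₁ found = found
  ... | inj₂ big = ⊥-elim (<⇒≱ big (∣p∣≤n (S (suc N))))

  module Decide {N n : ℕ} {Legal : Fin N → Fin N → Set} {Caught : Fin N → Fin n → Set}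
                {Flee : Fin n → Fin n → Set}
                (legal? : ∀ p q → Dec (Legal p q)) (caught? : ∀ p r → Dec (Caught p r))
                (flee? : ∀ r s → Dec (Flee r s)) where

    WinIn : ℕ → Fin N → Fin n → Set
    WinIn zero    p r = ⊥
    WinIn (suc j) p r = ∃[ p′ ] Legal p p′ × (Caught p′ r ⊎ (∀ r′ → Flee r r′ → WinIn j p′ r′))

    winIn? : ∀ j p r → Dec (WinIn j p r)
    winIn? zero    p r = no λ ()
    winIn? (suc j) p r = any? λ p′ → legal? p p′ ×-dec
      (caught? p′ r ⊎-dec all? λ r′ → flee? r r′ →-dec winIn? j p′ r′)

    winIn-suc : ∀ j {p r} → WinIn j p r → WinIn (suc j) p r
    winIn-suc (suc j) (p′ , l , inj₁ c) = p′ , l , inj₁ c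
    winIn-suc (suc j) (p′ , l , inj₂ f) = p′ , l , inj₂ λ r′ fl → winIn-suc j (f r′ fl)

    winIn⇒Win : ∀ j {p r} → WinIn j p r → Win Legal Caught Flee p r
    winIn⇒Win (suc j) (p′ , l , inj₁ c) = step p′ l (inj₁ c)
    winIn⇒Win (suc j) (p′ , l , inj₂ f) = step p′ l (inj₂ λ r′ fl → winIn⇒Win j (f r′ fl))

    WinInAt : ℕ → Fin (N * n) → Set
    WinInAt j s = WinIn j (proj₁ (remQuot {N} n s)) (proj₂ (remQuot {N} n s))

    winInAt? : ∀ j s → Dec (WinInAt j s)
    winInAt? j s = winIn? j _ _

    winInAt-combine : ∀ j p r → WinInAt j (combine p r) ≡ WinIn j p r
    winInAt-combine j p r = cong (λ s → WinIn j (proj₁ s) (proj₂ s)) (remQuot-combine {N} {n} p r)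

    stable : ∃[ j ] ∀ {p r} → WinIn (suc j) p r → WinIn j p r
    stable with stabilises (λ j → ⟦ winInAt? j ⟧)
                  (λ j {s} w → ∈⟦⟧⁺ (winInAt? (suc j)) {s} (winIn-suc j (∈⟦⟧⁻ (winInAt? j) {s} w)))
    ... | j , sub = j , λ {p} {r} w → subst id (winInAt-combine j p r) (∈⟦⟧⁻ (winInAt? j) {combine p r}
            (sub (∈⟦⟧⁺ (winInAt? (suc j)) {combine p r} (subst id (sym (winInAt-combine (suc j) p r)) w))))

    -- A stable stage `j` is closed under one more round, so induction on the tree puts every won
    -- position into it.
    Win⇒winIn : ∀ {j} → (∀ {p r} → WinIn (suc j) p r → WinIn j p r) →
                ∀ {p r} → Win Legal Caught Flee p r → WinIn j p r
    Win⇒winIn sub (step p′ l (inj₁ c)) = sub (p′ , l , inj₁ c)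
    Win⇒winIn sub (step p′ l (inj₂ f)) = sub (p′ , l , inj₂ λ r′ fl → Win⇒winIn sub (f r′ fl))

    win? : ∀ p r → Dec (Win Legal Caught Flee p r)
    win? p r = go stable
      where
      go : ∃[ j ] (∀ {p r} → WinIn (suc j) p r → WinIn j p r) → Dec (Win Legal Caught Flee p r)
      go (j , sub) = map′ (winIn⇒Win j) (Win⇒winIn sub) (winIn? j p r)

  least-witness : ∀ {P : ℕ → Set} → Decidable P → ∀ k → P k →
                  ∃[ c ] P c × (∀ m → P m → c ≤ m) × c ≤ k
  least-witness {P} P? k pk with P? 0
  ... | yes p₀ = 0 , p₀ , (λ _ _ → z≤n) , z≤n
  least-witness {P} P? zero    pk | no ¬p₀ = ⊥-elim (¬p₀ pk)
  least-witness {P} P? (suc k) pk | no ¬p₀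
    with least-witness (λ m → P? (suc m)) k pk
  ... | c , pc , least , c≤k = suc c , pc , least′ , s≤s c≤k
    where
    least′ : ∀ m → P m → suc c ≤ m
    least′ zero    p = ⊥-elim (¬p₀ p)
    least′ (suc m) p = s≤s (least m p)

  module _ {n : ℕ} (D : Digraph n) where

    move? : ∀ u v → Dec (Move D u v)
    move? = Reflₚ.dec _≟_ (Digraph._⟶?_ D)

    module Positions {k : ℕ} {Pos : Set} (at : Pos → Fin k → Fin n) where

      Legal : Pos → Pos → Set
      Legal p q = ∀ i → Move D (at p i) (at q i)

      Caught : Pos → Fin n → Set
      Caught p r = ∃[ i ] at p i ≡ r

      W : Pos → Fin n → Set
      W = Win Legal Caught (Move D)

      -- Cop play along a history, in a state that records whether the
      -- robber has respected the rules and the win is still pending.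
      module FromWin (p₀ : Pos) (w₀ : ∀ r → W p₀ r) where

        Ok : List (Fin n) → Fin n → Set
        Ok []      r′ = ⊤
        Ok (r ∷ _) r′ = Move D r r′

        ok? : ∀ h r → Dec (Ok h r)
        ok? []      r′ = yes tt
        ok? (r ∷ _) r′ = move? r r′

        data Plan (h : List (Fin n)) (p : Pos) : Set where
          active : (∀ r → Ok h r → W p r) → Plan h p
          idle   : Plan h p

        Next : List (Fin n) → Pos → Set
        Next h p = Σ Pos λ p′ → Legal p p′ × Plan h p′

        follow : ∀ {h p r} → W p r → Next (r ∷ h) p
        follow (step p′ l (inj₁ _)) = p′ , l , idle
        follow (step p′ l (inj₂ f)) = p′ , l , active f

        obey : ∀ {h p r} → (∀ r → Ok h r → W p r) → Dec (Ok h r) → Next (r ∷ h) p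
        obey {r = r} w (yes ok) = follow (w r ok)
        obey {p = p} w (no _)   = p , (λ _ → Refl.refl) , idle

        next : ∀ {h p} r → Plan h p → Next (r ∷ h) p
        next {p = p} r idle       = p , (λ _ → Refl.refl) , idle
        next {h}     r (active w) = obey w (ok? h r)

        drop-legal : ∀ {h p} → Next h p → Σ Pos (Plan h)
        drop-legal (p′ , _ , pl) = p′ , pl

        advance : ∀ {h} r → Σ Pos (Plan h) → Σ Pos (Plan (r ∷ h))
        advance r (p , pl) = drop-legal (next r pl)

        run : (h : List (Fin n)) → Σ Pos (Plan h)
        run [] = p₀ , active λ r _ → w₀ r
        run (r ∷ h) = advance r (run h)

        strategy : Strategy D k
        strategy = record
          { cops  = λ h → at (proj₁ (run h))
          ; legal = λ r h → proj₁ (proj₂ (next r (proj₂ (run h))))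
          }

        module _ (R : RobberPlay D) where
          open RobberPlay R

          -- Induction on the winning tree; the last hypothesis keeps `run` in step with its root.
          -- The history is passed as `ρ t ∷ h` because `history D ρ t` does not reduce for a
          -- variable `t`.
          chase : ∀ t {h p} → history D ρ t ≡ ρ t ∷ h → (w : W p (ρ t)) →
                  run (ρ t ∷ h) ≡ drop-legal (follow w) → ∃[ s ] CaughtAt D strategy R s
          chase t eqh (step p′ l (inj₁ (i , c))) eq =
            t , i , trans (cong (λ q → at q i) (trans (cong (λ h → proj₁ (run h)) eqh) (cong proj₁ eq))) c
          chase t {h} eqh (step p′ l (inj₂ f)) eq = continue (ok? (ρ t ∷ h) (ρ (suc t))) refl
            where
            continue : (d : Dec (Ok (ρ t ∷ h) (ρ (suc t)))) → ok? (ρ t ∷ h) (ρ (suc t)) ≡ d →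
                       ∃[ s ] CaughtAt D strategy R s
            continue (no ¬ok) _    = ⊥-elim (¬ok (legal t))
            continue (yes ok) eqok = chase (suc t) (cong (ρ (suc t) ∷_) eqh) (f (ρ (suc t)) ok)
              (trans (cong (advance (ρ (suc t))) eq) (cong (λ d → drop-legal (obey f d)) eqok))

          caught : ∃[ s ] CaughtAt D strategy R s
          caught = chase 0 refl (w₀ (ρ 0)) refl

      -- A robber outside `W` can stay outside forever against any `σ`. This is the converse that
      -- turns the decision of `W` into a decision of `CopsWin`. The encoding is a pointwise inverse
      -- only, which avoids function extensionality.
      module Evade (encode : (Fin k → Fin n) → Pos) (at-encode : ∀ f i → at (encode f) i ≡ f i)
                   (win? : ∀ p r → Dec (W p r)) (σ : Strategy D k) where
        open Strategy σ

        pos : List (Fin n) → Pos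
        pos h = encode (cops h)

        at-pos : ∀ h i → at (pos h) i ≡ cops h i
        at-pos h = at-encode (cops h)

        pos-legal : ∀ r h → Legal (pos h) (pos (r ∷ h))
        pos-legal r h i = subst₂ (Move D) (sym (at-pos h i)) (sym (at-pos (r ∷ h) i)) (legal r h i)

        record Free : Set where
          constructor free
          field
            hist : List (Fin n)
            here : Fin n
            safe : ¬ W (pos hist) here
        open Free

        escape : (s : Free) → ∃[ r′ ] Move D (here s) r′ × ¬ W (pos (here s ∷ hist s)) r′
        escape (free h r safe)
          with any? (λ r′ → move? r r′ ×-dec ¬? (win? (pos (r ∷ h)) r′))
        ... | yes found = found
        -- If all robber moves led to won positions, the move prescribed by `σ` would win from a
        -- position assumed safe.
        ... | no none = ⊥-elim (safe (step _ (pos-legal r h) (inj₂ λ r′ m →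
                decidable-stable (win? _ r′) λ ¬w → none (r′ , m , ¬w))))

        flee : Free → Free
        flee s = let (r′ , _ , safe′) = escape s in free (here s ∷ hist s) r′ safe′

        states : Free → ℕ → Free
        states s zero    = s
        states s (suc t) = flee (states s t)

        module _ (r₀ : Fin n) (safe₀ : ¬ W (pos []) r₀) where

          state : ℕ → Free
          state = states (free [] r₀ safe₀)

          play : RobberPlay D
          play = record { ρ = λ t → here (state t) ; legal = λ t → proj₁ (proj₂ (escape (state t))) }

          history≡ : ∀ t → history D (RobberPlay.ρ play) t ≡ here (state t) ∷ hist (state t)
          history≡ zero    = refl
          history≡ (suc t) = cong (here (state (suc t)) ∷_) (history≡ t)

          uncaught : ∀ t → ¬ CaughtAt D σ play t
          uncaught t (i , c) = safe (state t) (step (pos (r ∷ h)) (pos-legal r h) (inj₁ (i ,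
              trans (at-pos _ i) (subst (λ h → cops h i ≡ r) (history≡ t) c))))
            where
            h = hist (state t)
            r = here (state t)

        losing⇒¬winning : ∀ r → ¬ W (pos []) r → ¬ Winning D σ
        losing⇒¬winning r safe wins = let (t , c) = wins (play r safe) in uncaught r safe t c

    module Vectors (k : ℕ) where

      open Positions {k} {Fin (n ^ k)} finToFun public

      win? : ∀ p r → Dec (W p r)
      win? = Decide.win? {Caught = Caught} (λ p q → all? λ i → move? (finToFun p i) (finToFun q i))
        (λ p r → any? λ i → finToFun p i ≟ r) move?

      win⇒CopsWin : ∀ p → (∀ r → W p r) → CopsWin D k
      win⇒CopsWin p w = FromWin.strategy p w , FromWin.caught p w

      CopsWin⇒win : CopsWin D k → ∃[ p ] ∀ r → W p r
      CopsWin⇒win (σ , wins) = pos [] , λ r →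
        decidable-stable (win? _ r) λ ¬w → losing⇒¬winning r ¬w wins
        where open Evade funToFin finToFun-funToFin win? σ

      copsWin? : Dec (CopsWin D k)
      copsWin? = map′ (λ (p , w) → win⇒CopsWin p w) CopsWin⇒win (any? λ p → all? λ r → win? p r)

    copsWin⇒copNumber : ∀ k → CopsWin D k → ∃[ c ] IsCopNumber D c × c ≤ k
    copsWin⇒copNumber k wins =
      let (c , w , least , c≤k) = least-witness Vectors.copsWin? k wins in c , (w , least) , c≤k

-- Bernoulli's inequality and bounds for (1 + x/m)^m

module PowerBounds where
  open import Data.Nat
  open import Data.Nat.Properties
  open import Data.Nat.DivMod using (_/_; _%_; m≡m%n+[m/n]*n; m%n<n; m≥n⇒m/n>0)
  open import Data.Nat.Tactic.RingSolver using (solve-∀)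
  open import Data.Product using (_,_; ∃-syntax)
  open import Data.Sum using (_⊎_; inj₁; inj₂)
  open import Relation.Binary.PropositionalEquality
  open ≤-Reasoning

  -- Bernoulli's inequality (1 + d/m)^u ≥ 1 + ud/m, cleared of denominators.
  bernoulli : ∀ m d u → m ^ u * (m + u * d) ≤ m * (m + d) ^ u
  bernoulli m d zero    = ≤-reflexive (lem m)
    where
    lem : ∀ m → 1 * (m + 0) ≡ m * 1
    lem = solve-∀
  bernoulli m d (suc u) = begin
    m * m ^ u * (m + suc u * d)                  ≤⟨ m≤m+n _ (m ^ u * (u * d * d)) ⟩
    m * m ^ u * (m + suc u * d) + m ^ u * (u * d * d) ≡⟨ lem m d u (m ^ u) ⟩
    (m + d) * (m ^ u * (m + u * d))              ≤⟨ *-monoʳ-≤ (m + d) (bernoulli m d u) ⟩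
    (m + d) * (m * (m + d) ^ u)                  ≡⟨ lem₂ m (m + d) _ ⟩
    m * (m + d) ^ suc u                          ∎
    where
    lem : ∀ m d u x → m * x * (m + (1 + u) * d) + x * (u * d * d) ≡ (m + d) * (x * (m + u * d))
    lem = solve-∀
    lem₂ : ∀ m e x → e * (m * x) ≡ m * (e * x)
    lem₂ = solve-∀

  ^-distribʳ-* : ∀ k m n → (m * n) ^ k ≡ m ^ k * n ^ k
  ^-distribʳ-* zero    m n = refl
  ^-distribʳ-* (suc k) m n = trans (cong (m * n *_) (^-distribʳ-* k m n)) ([m*n]*[o*p]≡[m*o]*[n*p] m n (m ^ k) (n ^ k))

  -- (1 + 4p/m)^m ≥ 3^p, through (1 + 2/j)^j ≥ 3 with j = ⌊m/p⌋
  exp-lower-nat : ∀ p m .{{_ : NonZero p}} → p ≤ m → 3 ^ p * m ^ m ≤ (m + 4 * p) ^ m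
  exp-lower-nat p m p≤m = *-cancelˡ-≤ (j ^ (j * p)) {{m^n≢0 j (j * p)}} (begin
    j ^ (j * p) * (3 ^ p * m ^ m)
      ≡⟨ cong (λ e → j ^ (j * p) * (3 ^ p * m ^ e)) m≡ ⟩
    j ^ (j * p) * (3 ^ p * m ^ (j * p + s))
      ≡⟨ cong (λ e → j ^ (j * p) * (3 ^ p * e)) (^-distribˡ-+-* m (j * p) s) ⟩
    j ^ (j * p) * (3 ^ p * (m ^ (j * p) * m ^ s))
      ≡⟨ cong (λ e → e * (3 ^ p * (m ^ (j * p) * m ^ s))) (sym (^-*-assoc j j p)) ⟩
    (j ^ j) ^ p * (3 ^ p * (m ^ (j * p) * m ^ s))
      ≡⟨ lem ((j ^ j) ^ p) (3 ^ p) (m ^ (j * p)) (m ^ s) ⟩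
    (3 ^ p * (j ^ j) ^ p) * m ^ (j * p) * m ^ s
      ≡⟨ cong (λ e → e * m ^ (j * p) * m ^ s) (sym (^-distribʳ-* p 3 (j ^ j))) ⟩
    (3 * j ^ j) ^ p * m ^ (j * p) * m ^ s
      ≤⟨ *-monoˡ-≤ (m ^ s) (*-monoˡ-≤ (m ^ (j * p)) (^-monoˡ-≤ p three)) ⟩
    ((j + 2) ^ j) ^ p * m ^ (j * p) * m ^ s
      ≡⟨ cong (λ e → e * m ^ (j * p) * m ^ s) (^-*-assoc (j + 2) j p) ⟩
    (j + 2) ^ (j * p) * m ^ (j * p) * m ^ s
      ≡⟨ cong (_* m ^ s) (sym (^-distribʳ-* (j * p) (j + 2) m)) ⟩
    ((j + 2) * m) ^ (j * p) * m ^ s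
      ≤⟨ *-mono-≤ (^-monoˡ-≤ (j * p) base) (^-monoˡ-≤ s (m≤m+n m (4 * p))) ⟩
    (j * (m + 4 * p)) ^ (j * p) * (m + 4 * p) ^ s
      ≡⟨ cong (_* (m + 4 * p) ^ s) (^-distribʳ-* (j * p) j (m + 4 * p)) ⟩
    j ^ (j * p) * (m + 4 * p) ^ (j * p) * (m + 4 * p) ^ s
      ≡⟨ *-assoc (j ^ (j * p)) _ _ ⟩
    j ^ (j * p) * ((m + 4 * p) ^ (j * p) * (m + 4 * p) ^ s)
      ≡⟨ cong (j ^ (j * p) *_) (sym (^-distribˡ-+-* (m + 4 * p) (j * p) s)) ⟩
    j ^ (j * p) * (m + 4 * p) ^ (j * p + s)
      ≡⟨ cong (λ e → j ^ (j * p) * (m + 4 * p) ^ e) (sym m≡) ⟩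
    j ^ (j * p) * (m + 4 * p) ^ m ∎)
    where
    j = m / p
    s = m % p
    m≡ : m ≡ j * p + s
    m≡ = trans (m≡m%n+[m/n]*n m p) (+-comm s (j * p))
    j>0 : 0 < j
    j>0 = m≥n⇒m/n>0 p≤m
    instance
      j≢0 : NonZero j
      j≢0 = >-nonZero j>0
    lem : ∀ a b c d → a * (b * (c * d)) ≡ (b * a) * c * d
    lem = solve-∀
    three : 3 * j ^ j ≤ (j + 2) ^ j
    three = *-cancelˡ-≤ j (begin
      j * (3 * j ^ j)     ≡⟨ lem₁ j (j ^ j) ⟩
      j ^ j * (j + j * 2) ≤⟨ bernoulli j 2 j ⟩
      j * (j + 2) ^ j     ∎)
      where
      lem₁ : ∀ j x → j * (3 * x) ≡ x * (j + j * 2)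
      lem₁ = solve-∀
    base : (j + 2) * m ≤ j * (m + 4 * p)
    base = begin
      (j + 2) * m               ≡⟨ lem₁ j m ⟩
      j * m + 2 * m             ≡⟨ cong (λ e → j * m + 2 * e) m≡ ⟩
      j * m + 2 * (j * p + s)   ≤⟨ +-monoʳ-≤ (j * m) (*-monoʳ-≤ 2 (+-monoʳ-≤ (j * p) s≤)) ⟩
      j * m + 2 * (j * p + j * p) ≡⟨ lem₂ j m p ⟩
      j * (m + 4 * p)           ∎
      where
      s≤ : s ≤ j * p
      s≤ = ≤-trans (<⇒≤ (m%n<n m p)) (m≤n*m p j)
      lem₁ : ∀ j m → (j + 2) * m ≡ j * m + 2 * m
      lem₁ = solve-∀
      lem₂ : ∀ j m p → j * m + 2 * (j * p + j * p) ≡ j * (m + 4 * p)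
      lem₂ = solve-∀

  -- Bernoulli's inequality (1 - 1/(m+1))^k ≥ 1 - k/(m+1). Naming m + 1 - k as `l` keeps truncated
  -- subtraction out; the induction raises `l` as `k` falls.
  bernoulli⁻ : ∀ m k l → k + l ≡ suc m → suc m ^ k * l ≤ m ^ k * suc m
  bernoulli⁻ m zero    l refl = ≤-refl
  bernoulli⁻ m (suc k) l eq = begin
    suc m * suc m ^ k * l       ≡⟨ lem (suc m) (suc m ^ k) l ⟩
    suc m ^ k * (suc m * l)     ≤⟨ *-monoʳ-≤ (suc m ^ k) base ⟩
    suc m ^ k * (m * suc l)     ≡⟨ lem₂ (suc m ^ k) m (suc l) ⟩
    m * (suc m ^ k * suc l)     ≤⟨ *-monoʳ-≤ m (bernoulli⁻ m k (suc l) (trans (+-suc k l) eq)) ⟩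
    m * (m ^ k * suc m)         ≡⟨ sym (*-assoc m (m ^ k) (suc m)) ⟩
    m * m ^ k * suc m           ∎
    where
    lem : ∀ e x l → e * x * l ≡ x * (e * l)
    lem = solve-∀
    lem₂ : ∀ x m l → x * (m * l) ≡ m * (x * l)
    lem₂ = solve-∀
    l≤m : l ≤ m
    l≤m = ≤-trans (m≤n+m l k) (≤-reflexive (suc-injective eq))
    base : suc m * l ≤ m * suc l
    base = begin
      l + m * l ≤⟨ +-monoˡ-≤ (m * l) l≤m ⟩
      m + m * l ≡⟨ sym (*-suc m l) ⟩
      m * suc l ∎

  half : ∀ m → ∃[ k ] (m ≡ k + k ⊎ m ≡ suc (k + k))
  half zero = 0 , inj₁ refl
  half (suc m) with half m
  ... | k , inj₁ eq = k , inj₂ (cong suc eq)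
  ... | k , inj₂ eq = suc k , inj₁ (trans (cong suc eq) (cong suc (sym (+-suc k k))))

  square-≤ : ∀ a b k → a ^ k ≤ 2 * b ^ k → a ^ (k + k) ≤ 4 * b ^ (k + k)
  square-≤ a b k h = begin
    a ^ (k + k)               ≡⟨ ^-distribˡ-+-* a k k ⟩
    a ^ k * a ^ k             ≤⟨ *-mono-≤ h h ⟩
    2 * b ^ k * (2 * b ^ k)   ≡⟨ lem (b ^ k) ⟩
    4 * (b ^ k * b ^ k)       ≡⟨ cong (4 *_) (sym (^-distribˡ-+-* b k k)) ⟩
    4 * b ^ (k + k)           ∎
    where
    lem : ∀ x → 2 * x * (2 * x) ≡ 4 * (x * x)
    lem = solve-∀

  -- (1 + 1/m)^m ≤ 4: half of the factors contribute at most 2 by bernoulli⁻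
  e≤4 : ∀ m → suc m ^ m ≤ 4 * m ^ m
  e≤4 m with half m
  ... | k , inj₁ refl = square-≤ (suc (k + k)) (k + k) k (*-cancelʳ-≤ _ _ (suc k) (begin
    suc (k + k) ^ k * suc k         ≤⟨ bernoulli⁻ (k + k) k (suc k) (+-suc k k) ⟩
    (k + k) ^ k * suc (k + k)       ≤⟨ *-monoʳ-≤ ((k + k) ^ k) (s≤s (+-monoʳ-≤ k (n≤1+n k))) ⟩
    (k + k) ^ k * (suc k + suc k)   ≡⟨ lem ((k + k) ^ k) (suc k) ⟩
    2 * (k + k) ^ k * suc k         ∎))
    where
    lem : ∀ x k → x * (k + k) ≡ 2 * x * k
    lem = solve-∀
  ... | k , inj₂ refl = *-cancelˡ-≤ (suc m′) (begin
    suc m′ * suc m′ ^ m′           ≡⟨ cong (suc m′ ^_) ssk ⟩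
    suc m′ ^ (suc k + suc k)       ≤⟨ square-≤ (suc m′) m′ (suc k) (*-cancelʳ-≤ _ _ (suc k) (begin
      suc m′ ^ suc k * suc k           ≤⟨ bernoulli⁻ m′ (suc k) (suc k) (sym ssk) ⟩
      m′ ^ suc k * suc m′              ≡⟨ cong (m′ ^ suc k *_) ssk ⟩
      m′ ^ suc k * (suc k + suc k)     ≡⟨ lem (m′ ^ suc k) (suc k) ⟩
      2 * m′ ^ suc k * suc k           ∎)) ⟩
    4 * m′ ^ (suc k + suc k)       ≡⟨ cong (λ e → 4 * m′ ^ e) (sym ssk) ⟩
    4 * (m′ * m′ ^ m′)             ≡⟨ lem₂ m′ (m′ ^ m′) ⟩
    m′ * (4 * m′ ^ m′)             ≤⟨ *-monoˡ-≤ (4 * m′ ^ m′) (n≤1+n m′) ⟩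
    suc m′ * (4 * m′ ^ m′)         ∎)
    where
    m′ = suc (k + k)
    ssk : suc m′ ≡ suc k + suc k
    ssk = cong suc (sym (+-suc k k))
    lem : ∀ x k → x * (k + k) ≡ 2 * x * k
    lem = solve-∀
    lem₂ : ∀ m x → 4 * (m * x) ≡ m * (4 * x)
    lem₂ = solve-∀

  -- (1 + u/m)^m ≤ 4^u, since 1 + u/m ≤ (1 + 1/m)^u
  exp-upper-nat : ∀ u m .{{_ : NonZero m}} → (m + u) ^ m ≤ 4 ^ u * m ^ m
  exp-upper-nat u m = *-cancelˡ-≤ (m ^ (u * m)) {{m^n≢0 m (u * m)}} (begin
    m ^ (u * m) * (m + u) ^ m            ≡⟨ cong (_* (m + u) ^ m) (sym (^-*-assoc m u m)) ⟩
    (m ^ u) ^ m * (m + u) ^ m            ≡⟨ sym (^-distribʳ-* m (m ^ u) (m + u)) ⟩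
    (m ^ u * (m + u)) ^ m                ≤⟨ ^-monoˡ-≤ m base ⟩
    (m * suc m ^ u) ^ m                  ≡⟨ ^-distribʳ-* m m (suc m ^ u) ⟩
    m ^ m * (suc m ^ u) ^ m              ≡⟨ cong (m ^ m *_) swap ⟩
    m ^ m * (suc m ^ m) ^ u              ≤⟨ *-monoʳ-≤ (m ^ m) (^-monoˡ-≤ u (e≤4 m)) ⟩
    m ^ m * (4 * m ^ m) ^ u              ≡⟨ cong (m ^ m *_) (^-distribʳ-* u 4 (m ^ m)) ⟩
    m ^ m * (4 ^ u * (m ^ m) ^ u)        ≡⟨ cong (λ e → m ^ m * (4 ^ u * e)) (trans (^-*-assoc m m u) (cong (m ^_) (*-comm m u))) ⟩
    m ^ m * (4 ^ u * m ^ (u * m))        ≡⟨ lem (m ^ m) (4 ^ u) (m ^ (u * m)) ⟩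
    m ^ (u * m) * (4 ^ u * m ^ m)        ∎)
    where
    lem : ∀ a b c → a * (b * c) ≡ c * (b * a)
    lem = solve-∀
    swap : (suc m ^ u) ^ m ≡ (suc m ^ m) ^ u
    swap = trans (^-*-assoc (suc m) u m) (trans (cong (suc m ^_) (*-comm u m)) (sym (^-*-assoc (suc m) m u)))
    base : m ^ u * (m + u) ≤ m * suc m ^ u
    base = begin
      m ^ u * (m + u)     ≡⟨ cong (λ e → m ^ u * (m + e)) (sym (*-identityʳ u)) ⟩
      m ^ u * (m + u * 1) ≤⟨ bernoulli m 1 u ⟩
      m * (m + 1) ^ u     ≡⟨ cong (λ e → m * e ^ u) (+-comm m 1) ⟩
      m * suc m ^ u       ∎

-- Rational brackets for exp, log and log log

module CutBounds where
  open import Data.Nat as ℕ using (ℕ; zero; suc)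
  import Data.Nat.Properties as ℕₚ
  open import Data.Integer as ℤ using (ℤ; +_)
  import Data.Integer.Properties as ℤₚ
  open import Data.Rational
  open import Data.Rational.Properties
  import Data.Rational.Unnormalised as ℚᵘ
  import Data.Rational.Unnormalised.Properties as ℚᵘₚ
  open import Data.Rational.Solver using (module +-*-Solver)
  open import Algebra.Definitions.RawSemiring +-*-rawSemiring using () renaming (_^_ to _^ℚ_)
  open import Data.Product using (_,_; ∃-syntax)
  open import Relation.Binary.PropositionalEquality
  open Cut
  open PowerBounds

  ι : ℕ → ℚ
  ι k = + k / 1

  toℚᵘ-ι : ∀ k → toℚᵘ (ι k) ℚᵘ.≃ ℚᵘ.mkℚᵘ (+ k) 0
  toℚᵘ-ι k = toℚᵘ-fromℚᵘ (ℚᵘ.mkℚᵘ (+ k) 0)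

  ι-+ : ∀ a b → ι (a ℕ.+ b) ≡ ι a + ι b
  ι-+ a b = toℚᵘ-injective (ℚᵘₚ.≃-trans (toℚᵘ-ι (a ℕ.+ b)) (ℚᵘₚ.≃-sym
    (ℚᵘₚ.≃-trans (toℚᵘ-homo-+ (ι a) (ι b)) (ℚᵘₚ.≃-trans
      (ℚᵘₚ.+-cong (toℚᵘ-ι a) (toℚᵘ-ι b))
      (ℚᵘ.*≡* (cong (ℤ._* + 1) (cong₂ ℤ._+_ (ℤₚ.*-identityʳ (+ a)) (ℤₚ.*-identityʳ (+ b)))))))))

  ι-* : ∀ a b → ι (a ℕ.* b) ≡ ι a * ι b
  ι-* a b = toℚᵘ-injective (ℚᵘₚ.≃-trans (toℚᵘ-ι (a ℕ.* b)) (ℚᵘₚ.≃-sym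
    (ℚᵘₚ.≃-trans (toℚᵘ-homo-* (ι a) (ι b)) (ℚᵘₚ.≃-trans
      (ℚᵘₚ.*-cong (toℚᵘ-ι a) (toℚᵘ-ι b))
      (ℚᵘ.*≡* (cong (ℤ._* + 1) (sym (ℤₚ.pos-* a b))))))))

  ι-mono-≤ : ∀ {a b} → a ℕ.≤ b → ι a ≤ ι b
  ι-mono-≤ {a} {b} a≤b = toℚᵘ-cancel-≤ (ℚᵘₚ.≤-respˡ-≃ (ℚᵘₚ.≃-sym (toℚᵘ-ι a))
    (ℚᵘₚ.≤-respʳ-≃ (ℚᵘₚ.≃-sym (toℚᵘ-ι b))
      (ℚᵘ.*≤* (ℤₚ.*-monoʳ-≤-nonNeg (+ 1) (ℤ.+≤+ a≤b)))))

  ι-mono-< : ∀ {a b} → a ℕ.< b → ι a < ι b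
  ι-mono-< {a} {b} a<b = toℚᵘ-cancel-< (ℚᵘₚ.<-respˡ-≃ (ℚᵘₚ.≃-sym (toℚᵘ-ι a))
    (ℚᵘₚ.<-respʳ-≃ (ℚᵘₚ.≃-sym (toℚᵘ-ι b))
      (ℚᵘ.*<* (ℤₚ.*-monoʳ-<-pos (+ 1) (ℤ.+<+ a<b)))))

  ι-inverse : ∀ k → ι (suc k) * (+ 1 / suc k) ≡ 1ℚ
  ι-inverse k = toℚᵘ-injective (ℚᵘₚ.≃-trans (toℚᵘ-homo-* (ι (suc k)) (+ 1 / suc k))
    (ℚᵘₚ.≃-trans (ℚᵘₚ.*-cong (toℚᵘ-ι (suc k)) (toℚᵘ-fromℚᵘ (ℚᵘ.mkℚᵘ (+ 1) k)))
      (ℚᵘ.*≡* (trans (ℤₚ.*-identityʳ _) (trans (ℤₚ.*-identityʳ (+ suc k)) (sym (trans (ℤₚ.*-identityˡ _) (ℤₚ.*-identityˡ _))))))))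

  0<ι : ∀ {k} → 0 ℕ.< k → 0ℚ < ι k
  0<ι = ι-mono-<

  -- The hypothesis is y = a/b without division; comparisons of rational powers thus reduce to
  -- natural numbers.
  ι-^ : ∀ {y} a b → ι b * y ≡ ι a → ∀ m → ι (b ℕ.^ m) * y ^ℚ m ≡ ι (a ℕ.^ m)
  ι-^ a b eq zero = refl
  ι-^ {y} a b eq (suc m) = begin
    ι (b ℕ.* b ℕ.^ m) * (y * y ^ℚ m)   ≡⟨ cong (_* (y * y ^ℚ m)) (ι-* b (b ℕ.^ m)) ⟩
    ι b * ι (b ℕ.^ m) * (y * y ^ℚ m)   ≡⟨ solve 4 (λ p q r s → p :* q :* (r :* s) := (p :* r) :* (q :* s)) refl (ι b) (ι (b ℕ.^ m)) y (y ^ℚ m) ⟩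
    (ι b * y) * (ι (b ℕ.^ m) * y ^ℚ m) ≡⟨ cong₂ _*_ eq (ι-^ a b eq m) ⟩
    ι a * ι (a ℕ.^ m)                  ≡⟨ sym (ι-* a (a ℕ.^ m)) ⟩
    ι (a ℕ.* a ℕ.^ m)                  ∎
    where
    open ≡-Reasoning
    open +-*-Solver

  module _ (k m : ℕ) where
    private
      y = 1ℚ + ι k * (+ 1 / suc m)
      d = suc m ℕ.^ suc m
      instance
        d>0 : Positive (ι d)
        d>0 = positive (0<ι (ℕₚ.m^n>0 (suc m) (suc m)))

      base : ι (suc m) * y ≡ ι (suc m ℕ.+ k)
      base = begin
        ι (suc m) * (1ℚ + ι k * (+ 1 / suc m))
          ≡⟨ solve 3 (λ a b c → a :* (con 1ℚ :+ b :* c) := a :+ b :* (a :* c)) refl (ι (suc m)) (ι k) (+ 1 / suc m) ⟩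
        ι (suc m) + ι k * (ι (suc m) * (+ 1 / suc m)) ≡⟨ cong (λ z → ι (suc m) + ι k * z) (ι-inverse m) ⟩
        ι (suc m) + ι k * 1ℚ                          ≡⟨ cong (λ z → ι (suc m) + z) (*-identityʳ (ι k)) ⟩
        ι (suc m) + ι k                               ≡⟨ sym (ι-+ (suc m) k) ⟩
        ι (suc m ℕ.+ k)                               ∎
        where
        open ≡-Reasoning
        open +-*-Solver

      power : ι d * y ^ℚ suc m ≡ ι ((suc m ℕ.+ k) ℕ.^ suc m)
      power = ι-^ {y} (suc m ℕ.+ k) (suc m) base (suc m)

    exp-term-≥ : ∀ c → c ℕ.* d ℕ.≤ (suc m ℕ.+ k) ℕ.^ suc m → ι c ≤ y ^ℚ suc m
    exp-term-≥ c h = *-cancelˡ-≤-pos (ι d) (begin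
      ι d * ι c                       ≡⟨ trans (*-comm (ι d) (ι c)) (sym (ι-* c d)) ⟩
      ι (c ℕ.* d)                     ≤⟨ ι-mono-≤ h ⟩
      ι ((suc m ℕ.+ k) ℕ.^ suc m)     ≡⟨ sym power ⟩
      ι d * y ^ℚ suc m                ∎)
      where open ≤-Reasoning

    exp-term-≤ : ∀ c → (suc m ℕ.+ k) ℕ.^ suc m ℕ.≤ c ℕ.* d → y ^ℚ suc m ≤ ι c
    exp-term-≤ c h = *-cancelˡ-≤-pos (ι d) (begin
      ι d * y ^ℚ suc m                ≡⟨ power ⟩
      ι ((suc m ℕ.+ k) ℕ.^ suc m)     ≤⟨ ι-mono-≤ h ⟩
      ι (c ℕ.* d)                     ≡⟨ trans (ι-* c d) (*-comm (ι c) (ι d)) ⟩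
      ι d * ι c                       ∎)
      where open ≤-Reasoning

  -- The crude bounds 3^p ≤ e^(4p) here and e^u ≤ 4^u in `exp-above` suffice, since they distort
  -- logarithms by constant factors only. The limit threshold is `p` because `exp-lower-nat` asks
  -- for p ≤ m.
  exp-below : ∀ p {w} → 0 ℕ.< p → w < ι (3 ℕ.^ p) → Below (exp (ι (4 ℕ.* p))) w
  exp-below p p>0 w< = ι (3 ℕ.^ p) , w< , p , λ m p≤m →
    exp-term-≥ (4 ℕ.* p) m (3 ℕ.^ p) (exp-lower-nat p (suc m) {{ℕ.>-nonZero p>0}} (ℕₚ.m≤n⇒m≤1+n p≤m))

  exp-above : ∀ u {w} → ι (4 ℕ.^ u) < w → Above (exp (ι u)) w
  exp-above u <w = ι (4 ℕ.^ u) , <w , 0 , λ m _ →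
    exp-term-≤ u m (4 ℕ.^ u) (exp-upper-nat u (suc m))

  log-below : ∀ {n u} → 4 ℕ.^ u ℕ.< n → Below (log (fromℕ n)) (ι u)
  log-below {n} {u} h =
    let (w , l , r) = <-dense {ι (4 ℕ.^ u)} {ι n} (ι-mono-< {4 ℕ.^ u} {n} h) in w , exp-above u {w} l , r

  log-above : ∀ {n p} → 0 ℕ.< p → n ℕ.< 3 ℕ.^ p → Above (log (fromℕ n)) (ι (4 ℕ.* p))
  log-above {n} {p} p>0 h =
    let (w , l , r) = <-dense {ι n} {ι (3 ℕ.^ p)} (ι-mono-< {n} {3 ℕ.^ p} h) in w , l , exp-below p {w} p>0 r

  loglog-below : ∀ {n u v} → 4 ℕ.^ v ℕ.< u → 4 ℕ.^ u ℕ.< n → Below (log (log (fromℕ n))) (ι v)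
  loglog-below {n} {u} {v} h h′ = ι u , exp-above v (ι-mono-< h) , log-below {n} {u} h′

  loglog-above : ∀ {n p q} → 0 ℕ.< p → n ℕ.< 3 ℕ.^ p → 0 ℕ.< q → 4 ℕ.* p ℕ.< 3 ℕ.^ q →
                 Above (log (log (fromℕ n))) (ι (4 ℕ.* q))
  loglog-above {n} {p} {q} p>0 h q>0 h′ = ι (4 ℕ.* p) , log-above {n} p>0 h , exp-below q q>0 (ι-mono-< h′)

  -- A lower bound for a product of cuts asks for upper bounds of the factors as well, so positive
  -- brackets are propagated whole.
  record Between (x : Cut) (a b : ℚ) : Set where
    constructor between
    field
      below    : Below x a
      above    : Above x b
      0<lower  : 0ℚ < a
      ordered  : a ≤ b
  open Between

  *-mono-≤-pos : ∀ {a b c d} → 0ℚ < a → 0ℚ < c → a ≤ b → c ≤ d → a * c ≤ b * d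
  *-mono-≤-pos {a} {b} {c} {d} a>0 c>0 a≤b c≤d = ≤-trans
    (*-monoʳ-≤-nonNeg c {{pos⇒nonNeg c {{positive c>0}}}} a≤b)
    (*-monoˡ-≤-nonNeg b {{pos⇒nonNeg b {{positive (<-≤-trans a>0 a≤b)}}}} c≤d)

  *-pos : ∀ {a b} → 0ℚ < a → 0ℚ < b → 0ℚ < a * b
  *-pos {a} {b} a>0 b>0 = positive⁻¹ (a * b) {{pos*pos⇒pos a {{positive a>0}} b {{positive b>0}}}}

  *-below : ∀ {x y a b c d q} → Between x a b → Between y c d → q < a * c → Below (x *ᶜ y) q
  *-below {a = a} {b} {c} {d} (between xa xb a>0 a≤b) (between yc yd c>0 c≤d) q< =
    a , b , c , d , (xa , xb , yc , yd) ,
    q< , <-≤-trans q< (*-mono-≤-pos a>0 c>0 ≤-refl c≤d) ,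
    <-≤-trans q< (*-mono-≤-pos a>0 c>0 a≤b ≤-refl) , <-≤-trans q< (*-mono-≤-pos a>0 c>0 a≤b c≤d)

  *-above : ∀ {x y a b c d q} → Between x a b → Between y c d → b * d < q → Above (x *ᶜ y) q
  *-above {a = a} {b} {c} {d} (between xa xb a>0 a≤b) (between yc yd c>0 c≤d) <q =
    a , b , c , d , (xa , xb , yc , yd) ,
    ≤-<-trans (*-mono-≤-pos a>0 c>0 a≤b c≤d) <q ,
    ≤-<-trans (*-mono-≤-pos a>0 d>0 a≤b ≤-refl) <q ,
    ≤-<-trans (*-mono-≤-pos b>0 c>0 ≤-refl c≤d) <q , <q
    where
    b>0 = <-≤-trans a>0 a≤b
    d>0 = <-≤-trans c>0 c≤d

  ½*<  : ∀ {a} → 0ℚ < a → ½ * a < a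
  ½*< {a} a>0 = subst (½ * a <_) (*-identityˡ a) (*-monoˡ-<-pos a {{positive a>0}} {½} {1ℚ} (*<* (ℤ.+<+ (ℕ.s≤s (ℕ.s≤s ℕ.z≤n)))))

  <*2 : ∀ {a} → 0ℚ < a → a < a + a
  <*2 {a} a>0 = subst (_< a + a) (+-identityˡ a) (+-monoˡ-< a a>0)

  0<½ : 0ℚ < ½
  0<½ = positive⁻¹ ½

  -- Membership in a product asks for strict inequality against the products of the ends, hence the
  -- halving and doubling; `M` absorbs the loss.
  between-* : ∀ {x y a b c d} → Between x a b → Between y c d →
              Between (x *ᶜ y) (½ * (a * c)) (b * d + b * d)
  between-* {a = a} {b} {c} {d} X Y = between
    (*-below X Y (½*< ac>0))
    (*-above X Y (<*2 bd>0))
    (*-pos 0<½ ac>0)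
    (≤-trans (<⇒≤ (½*< ac>0)) (≤-trans ac≤bd (<⇒≤ (<*2 bd>0))))
    where
    ac>0 = *-pos (0<lower X) (0<lower Y)
    ac≤bd = *-mono-≤-pos (0<lower X) (0<lower Y) (ordered X) (ordered Y)
    bd>0 = <-≤-trans ac>0 ac≤bd

  between-fromℚ : ∀ {p} → 0ℚ < p → Between (fromℚ p) (½ * p) (p + p)
  between-fromℚ p>0 = between (½*< p>0) (<*2 p>0) (*-pos 0<½ p>0) (≤-trans (<⇒≤ (½*< p>0)) (<⇒≤ (<*2 p>0)))

  -- `½ * b′` and `a′ + a′` leave room for the strict inequalities; the summand `b′` in the upper
  -- end makes the ends ordered without comparing `a′` and `b′`.
  between-⁻¹ : ∀ {x a b a′ b′} → Between x a b → b * b′ ≡ 1ℚ → a * a′ ≡ 1ℚ → 0ℚ < b′ →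
               Between (x ⁻¹ᶜ) (½ * b′) (a′ + a′ + b′)
  between-⁻¹ {x} {a} {b} {a′} {b′} (between xa xb a>0 a≤b) bb aa b′>0 = between
    (b , xb , subst (_< 1ℚ) (sym lower) (*<* (ℤ.+<+ (ℕ.s≤s (ℕ.s≤s ℕ.z≤n)))))
    (a , a>0 , xa , subst (1ℚ <_) (sym upper) upper<)
    (*-pos 0<½ b′>0)
    (≤-trans (<⇒≤ (½*< b′>0)) (subst (_≤ a′ + a′ + b′) (+-identityˡ b′) (+-monoˡ-≤ b′ (<⇒≤ a′+a′>0))))
    where
    open +-*-Solver
    b>0 = <-≤-trans a>0 a≤b
    lower : ½ * b′ * b ≡ ½
    lower = trans (solve 3 (λ h p q → h :* p :* q := h :* (q :* p)) refl ½ b′ b) (trans (cong (½ *_) bb) (*-identityʳ ½))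
    upper : (a′ + a′ + b′) * a ≡ (1ℚ + 1ℚ) + b′ * a
    upper = trans (solve 3 (λ p q r → (p :+ p :+ q) :* r := (r :* p :+ r :* p) :+ q :* r) refl a′ b′ a)
                  (cong (λ z → (z + z) + b′ * a) aa)
    upper< : 1ℚ < (1ℚ + 1ℚ) + b′ * a
    upper< = <-trans (<*2 (positive⁻¹ 1ℚ)) (subst (_< (1ℚ + 1ℚ) + b′ * a) (+-identityʳ (1ℚ + 1ℚ)) (+-monoʳ-< (1ℚ + 1ℚ) (*-pos b′>0 a>0)))
    a′>0 : 0ℚ < a′
    a′>0 = *-cancelˡ-<-nonNeg a {{pos⇒nonNeg a {{positive a>0}}}} (subst₂ _<_ (sym (*-zeroʳ a)) (sym aa) (positive⁻¹ 1ℚ))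
    a′+a′>0 : 0ℚ < a′ + a′
    a′+a′>0 = <-trans a′>0 (<*2 a′>0)

  module _ (M n u v p q : ℕ) (M>0 : 0 ℕ.< M) (v>0 : 0 ℕ.< v) (4^v<u : 4 ℕ.^ v ℕ.< suc u)
           (4^u<n : 4 ℕ.^ suc u ℕ.< n) (n<3^p : n ℕ.< 3 ℕ.^ suc p) (q>0 : 0 ℕ.< q) (4p<3^q : 4 ℕ.* suc p ℕ.< 3 ℕ.^ q)
           (u≤4p : suc u ℕ.≤ 4 ℕ.* suc p) (v≤4q : v ℕ.≤ 4 ℕ.* q) where
    private
      P = 4 ℕ.* suc p
      P⁻¹ = + 1 / P
      -- The product of lower ends that the bracket lemmas yield. Its eight factors ½ are the source
      -- of 256 = 2^8.
      lower = ½ * (½ * ι M * (½ * ι n)) * (½ * (½ * (ι v * (½ * (ι v * (½ * 1ℚ)))) * (½ * P⁻¹)))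

      lower-below : ∀ {x} → x < lower →
        Below (fromℚ (ι M) *ᶜ fromℕ n *ᶜ ((log (log (fromℕ n)) ^ᶜ 2) ÷ᶜ log (fromℕ n))) x
      lower-below = *-below
        (between-* (between-fromℚ (0<ι M>0)) (between-fromℚ (0<ι (ℕₚ.<-trans (ℕₚ.m^n>0 4 (suc u)) 4^u<n))))
        (between-* (between-* LL (between-* LL (between-fromℚ (positive⁻¹ 1ℚ)))) L⁻¹)
        where
        LL : Between (log (log (fromℕ n))) (ι v) (ι (4 ℕ.* q))
        LL = between (loglog-below {n} {suc u} {v} 4^v<u 4^u<n)
          (loglog-above {n} {suc p} {q} (ℕ.s≤s ℕ.z≤n) n<3^p q>0 4p<3^q) (0<ι v>0) (ι-mono-≤ v≤4q)
        L : Between (log (fromℕ n)) (ι (suc u)) (ι P)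
        L = between (log-below {n} {suc u} 4^u<n) (log-above {n} {suc p} (ℕ.s≤s ℕ.z≤n) n<3^p)
          (0<ι {suc u} (ℕ.s≤s ℕ.z≤n)) (ι-mono-≤ u≤4p)
        L⁻¹ : Between (log (fromℕ n) ⁻¹ᶜ) (½ * P⁻¹) (+ 1 / suc u + + 1 / suc u + P⁻¹)
        L⁻¹ = between-⁻¹ L (ι-inverse (p ℕ.+ 3 ℕ.* suc p)) (ι-inverse u) (positive⁻¹ P⁻¹ {{normalize-pos 1 P}})

      lower-scaled : lower * ι (256 ℕ.* P) ≡ ι (M ℕ.* n ℕ.* (v ℕ.* v))
      lower-scaled = begin
        lower * ι (256 ℕ.* P)
          ≡⟨ cong (lower *_) (ι-* 256 P) ⟩
        lower * (ι 256 * ι P)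
          ≡⟨ solve 7 (λ h m n v r k P → (h :* (h :* m :* (h :* n)) :* (h :* (h :* (v :* (h :* (v :* (h :* con 1ℚ)))) :* (h :* r)))) :* (k :* P)
                      := (h :* h :* h :* h :* h :* h :* h :* h :* k) :* (P :* r) :* (m :* n :* (v :* v)))
               refl ½ (ι M) (ι n) (ι v) P⁻¹ (ι 256) (ι P) ⟩
        (½ * ½ * ½ * ½ * ½ * ½ * ½ * ½ * ι 256) * (ι P * P⁻¹) * (ι M * ι n * (ι v * ι v))
          ≡⟨ cong (λ z → 1ℚ * z * (ι M * ι n * (ι v * ι v))) (ι-inverse (p ℕ.+ 3 ℕ.* suc p)) ⟩
        1ℚ * 1ℚ * (ι M * ι n * (ι v * ι v))
          ≡⟨ *-identityˡ _ ⟩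
        ι M * ι n * (ι v * ι v)
          ≡⟨ sym (trans (ι-* (M ℕ.* n) (v ℕ.* v)) (cong₂ _*_ (ι-* M n) (ι-* v v))) ⟩
        ι (M ℕ.* n ℕ.* (v ℕ.* v)) ∎
        where
        open ≡-Reasoning
        open +-*-Solver

    -- `v` bounds log log n from below and `P` bounds log n from above, which decides the size of
    -- the quotient: the hypothesis reads c ≤ M n v²/(256 P). `u` and `q` give the opposite ends of
    -- the brackets.
    n⟨loglog⟩²/log-≥ : ∀ c a → a ≡ 256 → c ℕ.* (a ℕ.* P) ℕ.≤ M ℕ.* n ℕ.* (v ℕ.* v) →
      fromℕ c ≤ᶜ fromℚ (ι M) *ᶜ fromℕ n *ᶜ ((log (log (fromℕ n)) ^ᶜ 2) ÷ᶜ log (fromℕ n))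
    n⟨loglog⟩²/log-≥ c _ refl c≤ x x<c = lower-below (<-≤-trans x<c (*-cancelʳ-≤-pos (ι (256 ℕ.* P)) {{positive (0<ι {256 ℕ.* P} (ℕ.s≤s ℕ.z≤n))}}
      (subst₂ _≤_ (ι-* c (256 ℕ.* P)) (sym lower-scaled) (ι-mono-≤ c≤))))

-- Counting in subsets of a finite set

module SubsetCounting where
  open import Data.Nat
  open import Data.Nat.Properties
  open import Algebra.Properties.CommutativeSemigroup +-commutativeSemigroup using (interchange)
  open import Data.Nat.Tactic.RingSolver using (solve-∀)
  open import Data.Bool using (true; false)
  open import Data.Fin using (Fin; zero; suc)
  open import Data.Fin.Properties using (any?)
  open import Data.Fin.Subset
  open import Data.Fin.Subset.Properties
  open import Data.Vec using ([]; _∷_; here; there)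
  open import Data.List using (List; []; _∷_; length; map; _++_; filter)
  open import Data.Nat.ListAction using (sum)
  open import Data.List.Properties using (length-map; length-++)
  open import Data.List.Relation.Unary.Any using (Any; here; there)
  import Data.List.Relation.Unary.Any.Properties as Anyₚ
  open import Data.List.Relation.Unary.All as All using (All; []; _∷_)
  open import Data.List.Membership.Propositional using () renaming (_∈_ to _∈ˡ_)
  open import Data.List.Membership.Propositional.Properties using (∈-map⁺; ∈-map⁻)
  open import Data.Product using (_×_; _,_; ∃-syntax)
  open import Data.Sum using (_⊎_; inj₁; inj₂)
  open import Data.Empty using (⊥-elim)
  open import Relation.Nullary using (yes; no)
  open import Relation.Nullary.Decidable using (¬?)
  open import Relation.Binary.PropositionalEquality hiding ([_])
  open PowerBounds using (bernoulli)

  private variable n : ℕ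

  ∣p∪q∣≤∣p∣+∣q∣ : ∀ (p q : Subset n) → ∣ p ∪ q ∣ ≤ ∣ p ∣ + ∣ q ∣
  ∣p∪q∣≤∣p∣+∣q∣ []          []          = z≤n
  ∣p∪q∣≤∣p∣+∣q∣ (true  ∷ p) (true  ∷ q) = s≤s (≤-trans (∣p∪q∣≤∣p∣+∣q∣ p q) (+-monoʳ-≤ ∣ p ∣ (n≤1+n _)))
  ∣p∪q∣≤∣p∣+∣q∣ (true  ∷ p) (false ∷ q) = s≤s (∣p∪q∣≤∣p∣+∣q∣ p q)
  ∣p∪q∣≤∣p∣+∣q∣ (false ∷ p) (true  ∷ q) = ≤-trans (s≤s (∣p∪q∣≤∣p∣+∣q∣ p q)) (≤-reflexive (sym (+-suc ∣ p ∣ ∣ q ∣)))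
  ∣p∪q∣≤∣p∣+∣q∣ (false ∷ p) (false ∷ q) = ∣p∪q∣≤∣p∣+∣q∣ p q

  x∈p─q⁻ : ∀ (p q : Subset n) {x} → x ∈ p ─ q → x ∈ p × x ∉ q
  x∈p─q⁻ p q {x} x∈ = p─q⊆p p q x∈ , go p q x∈
    where
    go : ∀ {n} (p q : Subset n) {x} → x ∈ p ─ q → x ∉ q
    go (_ ∷ p)     (false ∷ q) here       ()
    go (_ ∷ p)     (_ ∷ q)     (there x∈) (there x∈q) = go p q x∈ x∈q

  ∣p─q∣+∣q∣≡∣p∣ : ∀ (p q : Subset n) → q ⊆ p → ∣ p ─ q ∣ + ∣ q ∣ ≡ ∣ p ∣
  ∣p─q∣+∣q∣≡∣p∣ []          []          q⊆p = refl
  ∣p─q∣+∣q∣≡∣p∣ (true  ∷ p) (true  ∷ q) q⊆p = trans (+-suc ∣ p ─ q ∣ ∣ q ∣) (cong suc (∣p─q∣+∣q∣≡∣p∣ p q (drop-∷-⊆ q⊆p)))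
  ∣p─q∣+∣q∣≡∣p∣ (true  ∷ p) (false ∷ q) q⊆p = cong suc (∣p─q∣+∣q∣≡∣p∣ p q (drop-∷-⊆ q⊆p))
  ∣p─q∣+∣q∣≡∣p∣ (false ∷ p) (true  ∷ q) q⊆p with () ← q⊆p here
  ∣p─q∣+∣q∣≡∣p∣ (false ∷ p) (false ∷ q) q⊆p = ∣p─q∣+∣q∣≡∣p∣ p q (drop-∷-⊆ q⊆p)

  elements : Subset n → List (Fin n)
  elements []          = []
  elements (true  ∷ p) = zero ∷ map suc (elements p)
  elements (false ∷ p) = map suc (elements p)

  length-elements : ∀ (p : Subset n) → length (elements p) ≡ ∣ p ∣
  length-elements []          = refl
  length-elements (true  ∷ p) = cong suc (trans (length-map suc (elements p)) (length-elements p))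
  length-elements (false ∷ p) = trans (length-map suc (elements p)) (length-elements p)

  ∈-elements⁺ : ∀ {p : Subset n} {x} → x ∈ p → x ∈ˡ elements p
  ∈-elements⁺ {p = true  ∷ p} here       = here refl
  ∈-elements⁺ {p = true  ∷ p} (there x∈) = there (∈-map⁺ suc (∈-elements⁺ x∈))
  ∈-elements⁺ {p = false ∷ p} (there x∈) = ∈-map⁺ suc (∈-elements⁺ x∈)

  ∈-elements⁻ : ∀ {p : Subset n} {x} → x ∈ˡ elements p → x ∈ p
  ∈-elements⁻ {p = true  ∷ p} (here refl) = here
  ∈-elements⁻ {p = true  ∷ p} (there x∈) with _ , y∈ , refl ← ∈-map⁻ suc x∈ = there (∈-elements⁻ y∈)
  ∈-elements⁻ {p = false ∷ p} x∈         with _ , y∈ , refl ← ∈-map⁻ suc x∈ = there (∈-elements⁻ y∈)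

  module _ {n : ℕ} {A : Set} (f : A → Subset n) where

    ∈-⋃⁺ : ∀ {xs x v} → v ∈ˡ xs → x ∈ f v → x ∈ ⋃ (map f xs)
    ∈-⋃⁺ (here refl) x∈ = x∈p∪q⁺ (inj₁ x∈)
    ∈-⋃⁺ (there v∈)  x∈ = x∈p∪q⁺ (inj₂ (∈-⋃⁺ v∈ x∈))

    ∈-⋃⁻ : ∀ xs {x} → x ∈ ⋃ (map f xs) → ∃[ v ] v ∈ˡ xs × x ∈ f v
    ∈-⋃⁻ []       x∈ = ⊥-elim (∉⊥ x∈)
    ∈-⋃⁻ (v ∷ xs) x∈ with x∈p∪q⁻ (f v) _ x∈
    ... | inj₁ x∈v = v , here refl , x∈v
    ... | inj₂ x∈′ with ∈-⋃⁻ xs x∈′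
    ...   | w , w∈ , x∈w = w , there w∈ , x∈w

    ∣⋃∣≤ : ∀ {k} xs → (∀ {v} → v ∈ˡ xs → ∣ f v ∣ ≤ k) → ∣ ⋃ (map f xs) ∣ ≤ length xs * k
    ∣⋃∣≤ []       _ = ≤-reflexive (∣⊥∣≡0 n)
    ∣⋃∣≤ (v ∷ xs) h = ≤-trans (∣p∪q∣≤∣p∣+∣q∣ (f v) _) (+-mono-≤ (h (here refl)) (∣⋃∣≤ xs λ v∈ → h (there v∈)))

  fromList : List (Fin n) → Subset n
  fromList xs = ⋃ (map ⁅_⁆ xs)

  ∈-fromList⁺ : ∀ {xs : List (Fin n)} {x} → x ∈ˡ xs → x ∈ fromList xs
  ∈-fromList⁺ x∈ = ∈-⋃⁺ ⁅_⁆ x∈ (x∈⁅x⁆ _)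

  ∈-fromList⁻ : ∀ (xs : List (Fin n)) {x} → x ∈ fromList xs → x ∈ˡ xs
  ∈-fromList⁻ xs x∈ with ∈-⋃⁻ ⁅_⁆ xs x∈
  ... | v , v∈ , x∈v with refl ← x∈⁅y⁆⇒x≡y v x∈v = v∈

  ∣fromList∣≤ : ∀ (xs : List (Fin n)) → ∣ fromList xs ∣ ≤ length xs
  ∣fromList∣≤ xs = subst (∣ fromList xs ∣ ≤_) (*-identityʳ (length xs)) (∣⋃∣≤ ⁅_⁆ xs λ {v} _ → ≤-reflexive (∣⁅x⁆∣≡1 v))

  shrink : ∀ k (p : Subset n) → k ≤ ∣ p ∣ → ∃[ q ] q ⊆ p × ∣ q ∣ ≡ k
  shrink {n} zero p _ = ⊥ , ⊥⊆ , ∣⊥∣≡0 n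
  shrink (suc k) (true  ∷ p) (s≤s k≤) with shrink k p k≤
  ... | q , q⊆p , eq = true ∷ q , in⊆in q⊆p , cong suc eq
  shrink (suc k) (false ∷ p) k≤ with shrink (suc k) p k≤
  ... | q , q⊆p , eq = false ∷ q , out⊆ q⊆p , eq

  -- Greedy hitting sets

  ∑ : (Fin n → ℕ) → ℕ
  ∑ {zero}  f = 0
  ∑ {suc n} f = f zero + ∑ λ x → f (suc x)

  ∑-+ : ∀ (f g : Fin n → ℕ) → ∑ (λ x → f x + g x) ≡ ∑ f + ∑ g
  ∑-+ {zero}  f g = refl
  ∑-+ {suc n} f g = trans (cong (f zero + g zero +_) (∑-+ (λ x → f (suc x)) (λ x → g (suc x))))
                          (interchange (f zero) (g zero) _ _)

  ∑-bounded : ∀ k (f : Fin n → ℕ) → (∀ x → f x ≤ k) → ∑ f ≤ n * k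
  ∑-bounded {zero}  k f h = z≤n
  ∑-bounded {suc n} k f h = +-mono-≤ (h zero) (∑-bounded k (λ x → f (suc x)) λ x → h (suc x))

  ∑-zero : ∑ {n} (λ _ → 0) ≡ 0
  ∑-zero {zero}  = refl
  ∑-zero {suc n} = ∑-zero {n}

  indicator : Subset n → Fin n → ℕ
  indicator p x with x ∈? p
  ... | yes _ = 1
  ... | no _  = 0

  indicator-suc : ∀ s (p : Subset n) x → indicator (s ∷ p) (suc x) ≡ indicator p x
  indicator-suc s p x with x ∈? p
  ... | yes _ = refl
  ... | no _  = refl

  ∑-cong : ∀ {f g : Fin n → ℕ} → (∀ x → f x ≡ g x) → ∑ f ≡ ∑ g
  ∑-cong {zero}  h = refl
  ∑-cong {suc n} h = cong₂ _+_ (h zero) (∑-cong λ x → h (suc x))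

  ∑-indicator : ∀ (p : Subset n) → ∑ (indicator p) ≡ ∣ p ∣
  ∑-indicator []          = refl
  ∑-indicator (true  ∷ p) = cong suc (trans (∑-cong (indicator-suc true p)) (∑-indicator p))
  ∑-indicator (false ∷ p) = trans (∑-cong (indicator-suc false p)) (∑-indicator p)

  degree : List (Subset n) → Fin n → ℕ
  degree []       x = 0
  degree (p ∷ ps) x = indicator p x + degree ps x

  ∑-degree : ∀ (ps : List (Subset n)) → ∑ (degree ps) ≡ sum (map ∣_∣ ps)
  ∑-degree {n} []       = ∑-zero {n}
  ∑-degree (p ∷ ps) = trans (∑-+ (indicator p) (degree ps)) (cong₂ _+_ (∑-indicator p) (∑-degree ps))

  avoiding : Fin n → List (Subset n) → List (Subset n)
  avoiding x = filter λ p → ¬? (x ∈? p)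

  length-avoiding : ∀ x (ps : List (Subset n)) → length (avoiding x ps) + degree ps x ≡ length ps
  length-avoiding x []       = refl
  length-avoiding x (p ∷ ps) with x ∈? p
  ... | yes _ = trans (+-suc _ _) (cong suc (length-avoiding x ps))
  ... | no _  = cong suc (length-avoiding x ps)

  avoiding-dichotomy : ∀ x {p} (ps : List (Subset n)) → p ∈ˡ ps → x ∈ p ⊎ p ∈ˡ avoiding x ps
  avoiding-dichotomy x (p ∷ ps) (here refl) with x ∈? p
  ... | yes x∈p = inj₁ x∈p
  ... | no _    = inj₂ (here refl)
  avoiding-dichotomy x (p ∷ ps) (there p∈) with avoiding-dichotomy x ps p∈
  ... | inj₁ x∈ = inj₁ x∈
  ... | inj₂ p∈′ with x ∈? p
  ...   | yes _ = inj₂ p∈′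
  ...   | no _  = inj₂ (there p∈′)

  All-avoiding : ∀ {P : Subset n → Set} x {ps} → All P ps → All P (avoiding x ps)
  All-avoiding x []                 = []
  All-avoiding x (_∷_ {p} px pxs) with x ∈? p
  ... | yes _ = All-avoiding x pxs
  ... | no _  = px ∷ All-avoiding x pxs

  module Hitting {n : ℕ} (k : ℕ) where

    private
      N = suc n

    Large : List (Subset N) → Set
    Large = All λ p → k ≤ ∣ p ∣

    sum≥ : ∀ {ps} → Large ps → length ps * k ≤ sum (map ∣_∣ ps)
    sum≥ []       = z≤n
    sum≥ (h ∷ hs) = +-mono-≤ h (sum≥ hs)

    -- Double counting: the degrees sum to at least `k * length ps`, so some vertex reaches the
    -- average.
    popular : ∀ ps → Large ps → ∃[ x ] k * length ps ≤ N * degree ps x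
    popular ps large with any? (λ x → k * length ps ≤? N * degree ps x)
    ... | yes found = found
    ... | no none with k * length ps in eq
    ...   | zero  = ⊥-elim (none (zero , z≤n))
    -- If every vertex misses the bound `suc c`, each has `N * degree ps x` at most `c`; summing
    -- over the `N` vertices contradicts the double count.
    ...   | suc c = ⊥-elim (<-irrefl refl (begin-strict
              N * c              <⟨ *-monoʳ-< N (n<1+n c) ⟩
              N * suc c          ≡⟨ cong (N *_) (trans (sym eq) (*-comm k (length ps))) ⟩
              N * (length ps * k) ≤⟨ *-monoʳ-≤ N (sum≥ large) ⟩
              N * sum (map ∣_∣ ps) ≡⟨ cong (N *_) (sym (∑-degree ps)) ⟩
              N * ∑ (degree ps)  ≡⟨ ∑-scale N (degree ps) ⟩
              ∑ (λ x → N * degree ps x) ≤⟨ ∑-bounded c _ (λ x → s≤s⁻¹ (≰⇒> λ h → none (x , h))) ⟩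
              N * c ∎))
      where
      open ≤-Reasoning
      ∑-scale : ∀ {m} a (f : Fin m → ℕ) → a * ∑ f ≡ ∑ λ x → a * f x
      ∑-scale {zero}  a f = *-zeroʳ a
      ∑-scale {suc m} a f = trans (*-distribˡ-+ a (f zero) _) (cong (a * f zero +_) (∑-scale a λ x → f (suc x)))

    pick : ∀ ps → Large ps → ∃[ x ] N * length (avoiding x ps) ≤ (N ∸ k) * length ps
    pick ps large with popular ps large
    ... | x , pop = x , (begin
      N * length (avoiding x ps)         ≤⟨ m+n≤o⇒m≤o∸n _ (begin
        N * length (avoiding x ps) + k * length ps         ≤⟨ +-monoʳ-≤ (N * length (avoiding x ps)) pop ⟩
        N * length (avoiding x ps) + N * degree ps x       ≡⟨ sym (*-distribˡ-+ N (length (avoiding x ps)) _) ⟩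
        N * (length (avoiding x ps) + degree ps x)         ≡⟨ cong (N *_) (length-avoiding x ps) ⟩
        N * length ps ∎) ⟩
      N * length ps ∸ k * length ps      ≡⟨ sym (*-distribʳ-∸ (length ps) N k) ⟩
      (N ∸ k) * length ps                ∎)
      where open ≤-Reasoning

    Hits : List (Fin N) → Subset N → Set
    Hits xs p = Any (_∈ p) xs

    picks : ∀ q ps → Large ps → ∃[ xs ] ∃[ rest ] length xs ≡ q × Large rest ×
            N ^ q * length rest ≤ (N ∸ k) ^ q * length ps ×
            (∀ {p} → p ∈ˡ ps → Hits xs p ⊎ p ∈ˡ rest)
    picks zero    ps large = [] , ps , refl , large , ≤-refl , inj₂
    picks (suc q) ps large with pick ps large
    ... | x , few with picks q (avoiding x ps) (All-avoiding x large)
    ...   | xs , rest , len , large′ , few′ , hit = x ∷ xs , rest , cong suc len , large′ , (begin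
      N * N ^ q * length rest                          ≡⟨ *-assoc N (N ^ q) (length rest) ⟩
      N * (N ^ q * length rest)                        ≤⟨ *-monoʳ-≤ N few′ ⟩
      N * ((N ∸ k) ^ q * length (avoiding x ps))       ≡⟨ lem N ((N ∸ k) ^ q) (length (avoiding x ps)) ⟩
      (N ∸ k) ^ q * (N * length (avoiding x ps))       ≤⟨ *-monoʳ-≤ ((N ∸ k) ^ q) few ⟩
      (N ∸ k) ^ q * ((N ∸ k) * length ps)              ≡⟨ lem₂ ((N ∸ k) ^ q) (N ∸ k) (length ps) ⟩
      (N ∸ k) * (N ∸ k) ^ q * length ps                ∎) , hit′
      where
      open ≤-Reasoning
      lem : ∀ a b c → a * (b * c) ≡ b * (a * c)
      lem = solve-∀
      lem₂ : ∀ a b c → a * (b * c) ≡ b * a * c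
      lem₂ = solve-∀
      hit′ : ∀ {p} → p ∈ˡ ps → Hits (x ∷ xs) p ⊎ p ∈ˡ rest
      hit′ p∈ with avoiding-dichotomy x ps p∈
      ... | inj₁ x∈p = inj₁ (here x∈p)
      ... | inj₂ p∈′ with hit p∈′
      ...   | inj₁ h = inj₁ (there h)
      ...   | inj₂ r = inj₂ r

    -- Bernoulli with ratio k/(N - k): (N/(N - k))^q ≥ 1 + qk/(N - k) ≥ 2, as qk ≥ N. If `k` is at
    -- least `N`, the left side vanishes because `q` is positive.
    halving : ∀ q → N ≤ q * k → 2 * (N ∸ k) ^ q ≤ N ^ q
    halving q N≤qk with k ≤? N
    ... | no k≰N rewrite m≤n⇒m∸n≡0 (<⇒≤ (≰⇒> k≰N)) = zero-power q N≤qk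
      where
      zero-power : ∀ q → N ≤ q * k → 2 * 0 ^ q ≤ N ^ q
      zero-power (suc q) _ = z≤n
    ... | yes k≤N with N ∸ k in eq
    ...   | zero  = zero-power q N≤qk
      where
      zero-power : ∀ q → N ≤ q * k → 2 * 0 ^ q ≤ N ^ q
      zero-power (suc q) _ = z≤n
    ...   | suc y = *-cancelˡ-≤ (suc y) (begin
      suc y * (2 * suc y ^ q)         ≡⟨ lem (suc y) (suc y ^ q) ⟩
      suc y ^ q * (suc y + suc y)     ≤⟨ *-monoʳ-≤ (suc y ^ q) (+-monoʳ-≤ (suc y) (≤-trans (subst (_≤ N) eq (m∸n≤m N k)) N≤qk)) ⟩
      suc y ^ q * (suc y + q * k)     ≤⟨ bernoulli (suc y) k q ⟩
      suc y * (suc y + k) ^ q         ≡⟨ cong (λ z → suc y * z ^ q) (trans (cong (_+ k) (sym eq)) (m∸n+n≡m k≤N)) ⟩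
      suc y * N ^ q                   ∎)
      where
      open ≤-Reasoning
      lem : ∀ y z → y * (2 * z) ≡ z * (y + y)
      lem = solve-∀

    -- Each block of `q` greedy picks at least halves the number of sets not yet hit, so `b` blocks
    -- leave fewer than one.
    hitting : ∀ q → N ≤ q * k → ∀ b ps → Large ps → length ps < 2 ^ b →
              ∃[ xs ] length xs ≡ b * q × (∀ {p} → p ∈ˡ ps → Hits xs p)
    hitting q N≤qk zero    []      large len = [] , refl , λ ()
    hitting q N≤qk zero    (_ ∷ _) large (s≤s ())
    hitting q N≤qk (suc b) ps large len with picks q ps large
    ... | xs , rest , lenxs , large′ , few , hit
        with hitting q N≤qk b rest large′ (*-cancelˡ-< 2 _ _ (≤-<-trans half len))
      where
      open ≤-Reasoning
      half : 2 * length rest ≤ length ps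
      half = *-cancelˡ-≤ (N ^ q) {{m^n≢0 N q}} (begin
        N ^ q * (2 * length rest)           ≡⟨ lem (N ^ q) (length rest) ⟩
        2 * (N ^ q * length rest)           ≤⟨ *-monoʳ-≤ 2 few ⟩
        2 * ((N ∸ k) ^ q * length ps)       ≡⟨ sym (*-assoc 2 ((N ∸ k) ^ q) _) ⟩
        2 * (N ∸ k) ^ q * length ps         ≤⟨ *-monoˡ-≤ (length ps) (halving q N≤qk) ⟩
        N ^ q * length ps                   ∎)
        where
        lem : ∀ a b → a * (2 * b) ≡ 2 * (a * b)
        lem = solve-∀
    ...   | ys , lenys , hit₂ = xs ++ ys , trans (length-++ xs) (cong₂ _+_ lenxs lenys) , λ p∈ → go (hit p∈)
      where
      go : ∀ {p} → Hits xs p ⊎ p ∈ˡ rest → Hits (xs ++ ys) p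
      go (inj₁ h)  = Anyₚ.++⁺ˡ h
      go (inj₂ p∈) = Anyₚ.++⁺ʳ xs (hit₂ p∈)

-- Balls, expansion and private sets

module Balls {n : ℕ} (D : Digraph n) where
  open import Data.Nat
  open import Data.Nat.Properties
  open import Data.Nat.Tactic.RingSolver using (solve-∀)
  open import Data.Fin using (Fin; zero; suc)
  open import Data.Fin.Properties using (any?)
  open import Data.Fin.Subset
  open import Data.Fin.Subset.Properties
  open import Data.List using (List; []; _∷_; length; map; _++_)
  open import Data.List.Properties using (length-++)
  open import Data.List.Relation.Unary.Any using (here; there)
  open import Data.List.Relation.Unary.All as All using (All; []; _∷_)
  import Data.List.Relation.Unary.All.Properties as Allₚ
  open import Data.List.Membership.Propositional using () renaming (_∈_ to _∈ˡ_)
  open import Data.List.Membership.Propositional.Properties using (∈-++⁺ˡ; ∈-++⁺ʳ)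
  open import Data.Product using (_×_; _,_; ∃-syntax; proj₁; proj₂)
  open import Data.Sum using (_⊎_; inj₁; inj₂)
  open import Data.Empty using (⊥-elim)
  open import Relation.Nullary using (Dec; yes; no)
  open import Relation.Nullary.Decidable using (_×-dec_; _⊎-dec_)
  open import Relation.Binary.Construct.Closure.Reflexive using (refl)
  open import Relation.Binary.PropositionalEquality hiding ([_]) renaming (refl to ≡-refl)
  open FiniteGame using (⟦_⟧; ∈⟦⟧⁺; ∈⟦⟧⁻; move?)
  open SubsetCounting

  -- Built from `Move`, which allows waiting: walks can be padded to any greater length, so cops can
  -- arrive simultaneously.
  data Walk : ℕ → Fin n → Fin n → Set where
    stop : ∀ {u} → Walk 0 u u
    _∷_  : ∀ {m u v w} → Move D u v → Walk m v w → Walk (suc m) u w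

  wait : ∀ m u → Walk m u u
  wait zero    u = stop
  wait (suc m) u = refl ∷ wait m u

  walk-suc : ∀ {m u v} → Walk m u v → Walk (suc m) u v
  walk-suc w = refl ∷ w

  walk-≤ : ∀ {m m′ u v} → m ≤ m′ → Walk m u v → Walk m′ u v
  walk-≤ z≤n     stop    = wait _ _
  walk-≤ (s≤s h) (e ∷ w) = e ∷ walk-≤ h w

  module _ (T : Subset n) where

    -- Waiting is a move, so a vertex of `T` lies in its own out-neighbourhood. Hence out-balls
    -- cover every play of the robber within `T`, and removing the out-neighbourhood of such a
    -- vertex shrinks `T`.
    outNbhd : Fin n → Subset n
    outNbhd x = ⟦ (λ y → (y ∈? T) ×-dec move? D x y) ⟧

    ∈-outNbhd⁺ : ∀ {x y} → y ∈ T → Move D x y → y ∈ outNbhd x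
    ∈-outNbhd⁺ {x} y∈T e = ∈⟦⟧⁺ (λ y → (y ∈? T) ×-dec move? D x y) (y∈T , e)

    ∈-outNbhd⁻ : ∀ {x y} → y ∈ outNbhd x → y ∈ T × Move D x y
    ∈-outNbhd⁻ {x} = ∈⟦⟧⁻ (λ y → (y ∈? T) ×-dec move? D x y)

    outBall : Fin n → ℕ → Subset n
    outBall r zero    = ⁅ r ⁆
    outBall r (suc j) = ⋃ (map outNbhd (elements (outBall r j)))

    outBall-move : ∀ {r} j {x y} → x ∈ outBall r j → y ∈ T → Move D x y → y ∈ outBall r (suc j)
    outBall-move j x∈ y∈T e = ∈-⋃⁺ outNbhd (∈-elements⁺ x∈) (∈-outNbhd⁺ y∈T e)

    outBall⊆T : ∀ {r} → r ∈ T → ∀ j → outBall r j ⊆ T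
    outBall⊆T {r} r∈T zero    x∈ with ≡-refl ← x∈⁅y⁆⇒x≡y r x∈ = r∈T
    outBall⊆T {r} r∈T (suc j) x∈ with ∈-⋃⁻ outNbhd (elements (outBall r j)) x∈
    ... | _ , _ , x∈v = proj₁ (∈-outNbhd⁻ x∈v)

    ∣outBall∣≤ : ∀ {K r} → (∀ {x} → x ∈ T → ∣ outNbhd x ∣ ≤ K) → r ∈ T → ∀ j → ∣ outBall r j ∣ ≤ K ^ j
    ∣outBall∣≤ {K} {r} deg r∈T zero = ≤-reflexive (∣⁅x⁆∣≡1 r)
    ∣outBall∣≤ {K} {r} deg r∈T (suc j) = begin
      ∣ outBall r (suc j) ∣                ≤⟨ ∣⋃∣≤ outNbhd (elements (outBall r j)) (λ v∈ → deg (outBall⊆T r∈T j (∈-elements⁻ v∈))) ⟩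
      length (elements (outBall r j)) * K  ≡⟨ cong (_* K) (length-elements (outBall r j)) ⟩
      ∣ outBall r j ∣ * K                  ≤⟨ *-monoˡ-≤ K (∣outBall∣≤ deg r∈T j) ⟩
      K ^ j * K                            ≡⟨ *-comm (K ^ j) K ⟩
      K ^ suc j                            ∎
      where open ≤-Reasoning

    InStep : Subset n → Fin n → Set
    InStep B u = u ∈ B ⊎ (u ∈ T × ∃[ w ] w ∈ B × Move D u w)

    inStep? : ∀ B u → Dec (InStep B u)
    inStep? B u = (u ∈? B) ⊎-dec ((u ∈? T) ×-dec any? λ w → (w ∈? B) ×-dec move? D u w)

    inBall : Subset n → ℕ → Subset n
    inBall A zero    = A
    inBall A (suc j) = ⟦ inStep? (inBall A j) ⟧

    inBall-suc : ∀ A j → inBall A j ⊆ inBall A (suc j)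
    inBall-suc A j u∈ = ∈⟦⟧⁺ (inStep? (inBall A j)) (inj₁ u∈)

    inBall-step : ∀ {A} j {u w} → w ∈ inBall A j → u ∈ T → Move D u w → u ∈ inBall A (suc j)
    inBall-step {A} j w∈ u∈T e = ∈⟦⟧⁺ (inStep? (inBall A j)) (inj₂ (u∈T , _ , w∈ , e))

    inBall-mono-≤ : ∀ A {i j} → i ≤ j → inBall A i ⊆ inBall A j
    inBall-mono-≤ A {j = zero}  z≤n u∈ = u∈
    inBall-mono-≤ A {i} {suc j} i≤ u∈ with m≤n⇒m<n∨m≡n i≤
    ... | inj₁ (s≤s i≤j) = inBall-suc A j (inBall-mono-≤ A i≤j u∈)
    ... | inj₂ ≡-refl    = u∈

    inBall⊆T : ∀ {A} → A ⊆ T → ∀ j → inBall A j ⊆ T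
    inBall⊆T A⊆T zero    = A⊆T
    inBall⊆T {A} A⊆T (suc j) u∈ with ∈⟦⟧⁻ (inStep? (inBall A j)) u∈
    ... | inj₁ u∈′        = inBall⊆T A⊆T j u∈′
    ... | inj₂ (u∈T , _) = u∈T

    inBall-split : ∀ A j {u} → u ∈ inBall A j → ∃[ a ] a ∈ A × u ∈ inBall ⁅ a ⁆ j
    inBall-split A zero    u∈ = _ , u∈ , x∈⁅x⁆ _
    inBall-split A (suc j) u∈ with ∈⟦⟧⁻ (inStep? (inBall A j)) u∈
    ... | inj₁ u∈′ with inBall-split A j u∈′
    ...   | a , a∈ , u∈a = a , a∈ , inBall-suc ⁅ a ⁆ j u∈a
    inBall-split A (suc j) u∈ | inj₂ (u∈T , w , w∈ , e) with inBall-split A j w∈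
    ...   | a , a∈ , w∈a = a , a∈ , inBall-step j w∈a u∈T e

    inBall-walk : ∀ {v} j {u} → u ∈ inBall ⁅ v ⁆ j → Walk j u v
    inBall-walk {v} zero    u∈ with ≡-refl ← x∈⁅y⁆⇒x≡y v u∈ = stop
    inBall-walk {v} (suc j) u∈ with ∈⟦⟧⁻ (inStep? (inBall ⁅ v ⁆ j)) u∈
    ... | inj₁ u∈′              = walk-suc (inBall-walk j u∈′)
    ... | inj₂ (_ , _ , w∈ , e) = e ∷ inBall-walk j w∈

    boundary : Subset n → ℕ → Subset n
    boundary A j = inBall A (suc j) ─ inBall A j

    -- As long as each boundary exceeds a 1/K fraction of its ball, each step multiplies the ball by
    -- at least 1 + 1/K; powers of `K` clear the denominators.
    slowGrowth : ∀ K t A → (∃[ j ] j < t × K * ∣ boundary A j ∣ ≤ ∣ inBall A j ∣)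
                 ⊎ suc K ^ t * ∣ A ∣ ≤ K ^ t * ∣ inBall A t ∣
    slowGrowth K zero    A = inj₂ ≤-refl
    slowGrowth K (suc t) A with slowGrowth K t A
    ... | inj₁ (j , j<t , h) = inj₁ (j , m≤n⇒m≤1+n j<t , h)
    ... | inj₂ grown with K * ∣ boundary A t ∣ ≤? ∣ inBall A t ∣
    ...   | yes h = inj₁ (t , n<1+n t , h)
    ...   | no ¬h = inj₂ (begin
      suc K * suc K ^ t * ∣ A ∣                       ≡⟨ *-assoc (suc K) (suc K ^ t) ∣ A ∣ ⟩
      suc K * (suc K ^ t * ∣ A ∣)                     ≤⟨ *-monoʳ-≤ (suc K) grown ⟩
      suc K * (K ^ t * ∣ inBall A t ∣)                ≡⟨ lem K (K ^ t) ∣ inBall A t ∣ ⟩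
      K ^ t * (∣ inBall A t ∣ + K * ∣ inBall A t ∣)     ≤⟨ *-monoʳ-≤ (K ^ t) (+-monoˡ-≤ (K * ∣ inBall A t ∣) (<⇒≤ (≰⇒> ¬h))) ⟩
      K ^ t * (K * ∣ boundary A t ∣ + K * ∣ inBall A t ∣) ≡⟨ cong (K ^ t *_) (sym (*-distribˡ-+ K ∣ boundary A t ∣ _)) ⟩
      K ^ t * (K * (∣ boundary A t ∣ + ∣ inBall A t ∣))  ≡⟨ cong (λ z → K ^ t * (K * z)) (∣p─q∣+∣q∣≡∣p∣ (inBall A (suc t)) (inBall A t) (inBall-suc A t)) ⟩
      K ^ t * (K * ∣ inBall A (suc t) ∣)              ≡⟨ lem₂ K (K ^ t) _ ⟩
      K * K ^ t * ∣ inBall A (suc t) ∣                ∎)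
      where
      open ≤-Reasoning
      lem : ∀ K x b → (1 + K) * (x * b) ≡ x * (b + K * b)
      lem = solve-∀
      lem₂ : ∀ K x b → x * (K * b) ≡ K * x * b
      lem₂ = solve-∀

    module Assignment (t k : ℕ) where

      ball : Fin n → Subset n
      ball v = inBall ⁅ v ⁆ t

      Serves : (Fin n → Fin n) → Subset n → Fin n → Set
      Serves dest M v = ∀ {s} → s ∈ M → dest s ≡ v

      -- `U` is what is claimed beforehand, `used` what is claimed in the end. Disjointness is
      -- expressed through the single function `dest`, which must serve every private set: a cop has
      -- only one destination.
      record Greedy (U : Subset n) (vs : List (Fin n)) : Set where
        field
          dest     : Fin n → Fin n
          privates : List (Subset n)
          left     : List (Fin n)
          used     : Subset n
          walks    : ∀ s → Walk t s (dest s)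
          large    : All (λ M → k ≤ ∣ M ∣) privates
          served   : ∀ {v} → v ∈ˡ vs → v ∈ˡ left ⊎
                     ∃[ M ] M ∈ˡ privates × (∀ {s} → s ∈ M → s ∉ U) × Serves dest M v
          left⊆    : ∀ {v} → v ∈ˡ left → v ∈ˡ vs
          lengths  : length privates + length left ≡ length vs
          U⊆used   : U ⊆ used
          usedSize : ∣ used ∣ ≤ ∣ U ∣ + length privates * k
          exhausted : ∀ {v} → v ∈ˡ left → ∣ ball v ─ used ∣ ≤ k

      greedy : ∀ U vs → Greedy U vs
      greedy U [] = record
        { dest = λ s → s ; privates = [] ; left = [] ; used = U ; walks = wait t ; large = []
        ; served = λ () ; left⊆ = λ () ; lengths = ≡-refl ; U⊆used = λ s∈ → s∈
        ; usedSize = ≤-reflexive (sym (+-identityʳ ∣ U ∣)) ; exhausted = λ () }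
      -- A vertex is judged against `U` at its turn. Claims only grow, so one left over now still
      -- satisfies `exhausted` for the final `used`.
      greedy U (v ∷ vs) with k ≤? ∣ ball v ─ U ∣
      ... | no small = record
        { dest = dest ; privates = privates ; left = v ∷ left ; used = used ; walks = walks ; large = large
        ; served = served′ ; left⊆ = left⊆′
        ; lengths = trans (+-suc (length privates) (length left)) (cong suc lengths)
        ; U⊆used = U⊆used ; usedSize = usedSize ; exhausted = exhausted′ }
        where
        open Greedy (greedy U vs)
        served′ : ∀ {w} → w ∈ˡ v ∷ vs → _
        served′ (here ≡-refl) = inj₁ (here ≡-refl)
        served′ (there w∈) with served w∈
        ... | inj₁ w∈left = inj₁ (there w∈left)
        ... | inj₂ s      = inj₂ s
        left⊆′ : ∀ {w} → w ∈ˡ v ∷ left → w ∈ˡ v ∷ vs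
        left⊆′ (here ≡-refl) = here ≡-refl
        left⊆′ (there w∈)    = there (left⊆ w∈)
        exhausted′ : ∀ {w} → w ∈ˡ v ∷ left → ∣ ball w ─ used ∣ ≤ k
        exhausted′ (there w∈)    = exhausted w∈
        exhausted′ (here ≡-refl) = ≤-trans
          (p⊆q⇒∣p∣≤∣q∣ λ x∈ → let (x∈b , x∉u) = x∈p─q⁻ (ball v) used x∈ in
            x∈p∧x∉q⇒x∈p─q x∈b λ x∈U → x∉u (U⊆used x∈U))
          (<⇒≤ (≰⇒> small))
      ... | yes big = record
        { dest = dest′ ; privates = M ∷ privates ; left = left ; used = used ; walks = walks′
        ; large = ≤-reflexive (sym ∣M∣) ∷ large
        ; served = served′ ; left⊆ = λ w∈ → there (left⊆ w∈) ; lengths = cong suc lengths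
        ; U⊆used = λ s∈ → U⊆used (x∈p∪q⁺ (inj₁ s∈)) ; usedSize = usedSize′ ; exhausted = exhausted }
        where
        M = proj₁ (shrink k (ball v ─ U) big)
        M⊆ : M ⊆ ball v ─ U
        M⊆ = proj₁ (proj₂ (shrink k (ball v ─ U) big))
        ∣M∣ : ∣ M ∣ ≡ k
        ∣M∣ = proj₂ (proj₂ (shrink k (ball v ─ U) big))
        open Greedy (greedy (U ∪ M) vs)
        dest′ : Fin n → Fin n
        dest′ s with s ∈? M
        ... | yes _ = v
        ... | no _  = dest s
        walks′ : ∀ s → Walk t s (dest′ s)
        walks′ s with s ∈? M
        ... | yes s∈ = inBall-walk t (p─q⊆p _ _ (M⊆ s∈))
        ... | no _   = walks s
        served′ : ∀ {w} → w ∈ˡ v ∷ vs → w ∈ˡ left ⊎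
                  ∃[ M′ ] M′ ∈ˡ M ∷ privates × (∀ {s} → s ∈ M′ → s ∉ U) × Serves dest′ M′ w
        served′ (here ≡-refl) = inj₂ (M , here ≡-refl , (λ s∈ → proj₂ (x∈p─q⁻ (ball v) U (M⊆ s∈))) , serves)
          where
          serves : Serves dest′ M v
          serves {s} s∈ with s ∈? M
          ... | yes _ = ≡-refl
          ... | no s∉ = ⊥-elim (s∉ s∈)
        served′ {w} (there w∈) with served w∈
        ... | inj₁ w∈left = inj₁ w∈left
        ... | inj₂ (M′ , M′∈ , avoids , serves) = inj₂ (M′ , there M′∈ ,
                (λ s∈ s∈U → avoids s∈ (x∈p∪q⁺ (inj₁ s∈U))) , serves′)
          where
          serves′ : Serves dest′ M′ w
          serves′ {s} s∈ with s ∈? M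
          ... | yes s∈M = ⊥-elim (avoids s∈ (x∈p∪q⁺ (inj₂ s∈M)))
          ... | no _    = serves s∈
        usedSize′ : ∣ used ∣ ≤ ∣ U ∣ + (k + length privates * k)
        usedSize′ = begin
          ∣ used ∣                                ≤⟨ usedSize ⟩
          ∣ U ∪ M ∣ + length privates * k         ≤⟨ +-monoˡ-≤ _ (∣p∪q∣≤∣p∣+∣q∣ U M) ⟩
          ∣ U ∣ + ∣ M ∣ + length privates * k     ≡⟨ cong (λ z → ∣ U ∣ + z + length privates * k) ∣M∣ ⟩
          ∣ U ∣ + k + length privates * k         ≡⟨ +-assoc ∣ U ∣ k _ ⟩
          ∣ U ∣ + (k + length privates * k)       ∎
          where open ≤-Reasoning

      -- A Hall-type condition. Its factor 2 beyond the size `k` of a private set is what makes one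
      -- greedy pass serve at least half of the vertices.
      Expanding : ℕ → Set
      Expanding a = ∀ A → A ⊆ T → ∣ A ∣ ≤ a → 2 * k * ∣ A ∣ ≤ ∣ inBall A t ∣

      left⊆A : ∀ {A} (g : Greedy ⊥ (elements A)) → fromList (Greedy.left g) ⊆ A
      left⊆A g x∈ = ∈-elements⁻ (Greedy.left⊆ g (∈-fromList⁻ (Greedy.left g) x∈))

      -- Every in-ball of a vertex left over is used up except for k vertices, so
      -- by expansion at most half of the vertices are left over.
      left-small : ∀ {a} .{{_ : NonZero k}} → Expanding a → ∀ A → A ⊆ T → ∣ A ∣ ≤ a →
                   (g : Greedy ⊥ (elements A)) → 2 * ∣ fromList (Greedy.left g) ∣ ≤ ∣ A ∣
      left-small {a} expanding A A⊆T A≤ g = *-cancelˡ-≤ k (begin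
          k * (2 * ∣ A₁ ∣)                      ≡⟨ lem k ∣ A₁ ∣ ⟩
          2 * k * ∣ A₁ ∣                        ≤⟨ expanding A₁ (λ x∈ → A⊆T (A₁⊆A x∈)) (≤-trans (p⊆q⇒∣p∣≤∣q∣ A₁⊆A) A≤) ⟩
          ∣ inBall A₁ t ∣                       ≤⟨ p⊆q⇒∣p∣≤∣q∣ covered ⟩
          ∣ used ∪ rest ∣                       ≤⟨ ∣p∪q∣≤∣p∣+∣q∣ used rest ⟩
          ∣ used ∣ + ∣ rest ∣                   ≤⟨ +-mono-≤ usedSize (∣⋃∣≤ (λ v → ball v ─ used) left exhausted) ⟩
          ∣ ⊥ {n} ∣ + length privates * k + length left * k
                                               ≡⟨ cong (λ z → z + length privates * k + length left * k) (∣⊥∣≡0 n) ⟩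
          length privates * k + length left * k ≡⟨ sym (*-distribʳ-+ k (length privates) (length left)) ⟩
          (length privates + length left) * k   ≡⟨ cong (_* k) (trans lengths (length-elements A)) ⟩
          ∣ A ∣ * k                             ≡⟨ *-comm ∣ A ∣ k ⟩
          k * ∣ A ∣                             ∎)
        where
        open ≤-Reasoning
        open Greedy g
        A₁ = fromList left
        rest = ⋃ (map (λ v → ball v ─ used) left)
        A₁⊆A : A₁ ⊆ A
        A₁⊆A = left⊆A g
        lem : ∀ k x → k * (2 * x) ≡ 2 * k * x
        lem = solve-∀
        covered : inBall A₁ t ⊆ used ∪ rest
        covered {u} u∈ with u ∈? used
        ... | yes u∈used = x∈p∪q⁺ (inj₁ u∈used)
        ... | no u∉used with inBall-split A₁ t u∈
        ...   | v , v∈ , u∈v = x∈p∪q⁺ (inj₂ (∈-⋃⁺ (λ v → ball v ─ used) (∈-fromList⁻ left v∈) (x∈p∧x∉q⇒x∈p─q u∈v u∉used)))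

      -- Each stage uses its own copy of the cops, so that private sets need
      -- to be disjoint within a stage only.
      record Stages (J : ℕ) (A : Subset n) : Set where
        field
          dests  : List (Fin n → Fin n)
          count  : length dests ≡ J
          sets   : List (Subset n)
          walks  : All (λ dest → ∀ s → Walk t s (dest s)) dests
          large  : All (λ M → k ≤ ∣ M ∣) sets
          served : ∀ {v} → v ∈ A → ∃[ dest ] dest ∈ˡ dests × ∃[ M ] M ∈ˡ sets × Serves dest M v
          few    : length sets ≤ ∣ A ∣

      addStage : ∀ {J A} (g : Greedy ⊥ (elements A)) → Stages J (fromList (Greedy.left g)) → Stages (suc J) A
      addStage {J} {A} g S = record
        { dests = dest ∷ S.dests ; count = cong suc S.count ; sets = privates ++ S.sets
        ; walks = walks ∷ S.walks ; large = Allₚ.++⁺ large S.large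
        ; served = served′
        ; few = begin
            length (privates ++ S.sets)           ≡⟨ length-++ privates ⟩
            length privates + length S.sets       ≤⟨ +-monoʳ-≤ (length privates) (≤-trans S.few (∣fromList∣≤ left)) ⟩
            length privates + length left         ≡⟨ trans lengths (length-elements A) ⟩
            ∣ A ∣                                 ∎
        }
        where
        open ≤-Reasoning
        open Greedy g
        module S = Stages S
        served′ : ∀ {v} → v ∈ A → ∃[ d ] d ∈ˡ dest ∷ S.dests × ∃[ M ] M ∈ˡ privates ++ S.sets × Serves d M v
        served′ v∈ with served (∈-elements⁺ v∈)
        ... | inj₂ (M , M∈ , _ , serves) = dest , here ≡-refl , M , ∈-++⁺ˡ M∈ , serves
        ... | inj₁ v∈left with S.served (∈-fromList⁺ v∈left)
        ...   | d , d∈ , M , M∈ , serves = d , there d∈ , M , ∈-++⁺ʳ privates M∈ , serves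

      -- By `left-small` each stage at least halves what is unserved, so `J` stages serve fewer than
      -- 2^J vertices. Leftovers are subsets of `A`, so expansion still applies to them.
      stages : ∀ {a} .{{_ : NonZero k}} → Expanding a → ∀ J A → A ⊆ T → ∣ A ∣ ≤ a → ∣ A ∣ < 2 ^ J → Stages J A
      stages expanding zero A A⊆T A≤a A<1 = record
        { dests = [] ; count = ≡-refl ; sets = [] ; walks = [] ; large = [] ; few = z≤n
        ; served = λ v∈ → ⊥-elim (empty v∈) }
        where
        empty : ∀ {v} → v ∉ A
        empty {v} v∈ = <⇒≱ A<1 (≤-trans (≤-reflexive (sym (∣⁅x⁆∣≡1 v)))
          (p⊆q⇒∣p∣≤∣q∣ λ x∈ → subst (_∈ A) (sym (x∈⁅y⁆⇒x≡y v x∈)) v∈))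
      stages {a} expanding (suc J) A A⊆T A≤a A< = step (greedy ⊥ (elements A))
        where
        step : Greedy ⊥ (elements A) → Stages (suc J) A
        step g = addStage g (stages expanding J (fromList (Greedy.left g)) (λ x∈ → A⊆T (left⊆A g x∈))
          (≤-trans (p⊆q⇒∣p∣≤∣q∣ {p = fromList (Greedy.left g)} {A} (left⊆A {A} g)) A≤a)
          (*-cancelˡ-< 2 ∣ fromList (Greedy.left g) ∣ (2 ^ J) (≤-<-trans (left-small expanding A A⊆T A≤a g) A<)))

-- The cops' strategy

module Pursuit {n′ : ℕ} (D : Digraph (suc n′)) where
  open import Data.Nat
  open import Data.Nat.Properties
  open import Data.Fin using (Fin; zero; suc; cast; funToFin; finToFun)
  open import Data.Fin.Properties using (any?; cast-trans; cast-is-id; finToFun-funToFin)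
  open import Data.Fin.Subset hiding (⊤)
  open import Data.Fin.Subset using () renaming (⊤ to full)
  open import Data.Fin.Subset.Properties
  open import Data.List using (List; []; _∷_; length; map; _++_; replicate; concat; concatMap; allFin; lookup)
  open import Data.List.Properties using (length-++; ++-assoc; length-replicate; length-tabulate)
  open import Data.List.Relation.Unary.Any as Any using (Any; here; there; index)
  import Data.List.Relation.Unary.Any.Properties as Anyₚ
  open import Data.List.Relation.Unary.All as All using (All; []; _∷_)
  import Data.List.Relation.Unary.All.Properties as Allₚ
  open import Data.List.Relation.Binary.Pointwise as PW using (Pointwise; []; _∷_; Pointwise-length)
  open import Data.List.Membership.Propositional using (lose) renaming (_∈_ to _∈ˡ_)
  open import Data.List.Membership.Propositional.Properties
  open import Data.Product using (_×_; _,_; ∃-syntax; proj₁; proj₂)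
  open import Data.Sum as Sum using (_⊎_; inj₁; inj₂)
  open import Data.Empty using (⊥-elim)
  open import Relation.Nullary using (Dec; yes; no)
  open import Relation.Nullary.Decidable using (_×-dec_)
  open import Relation.Binary.Construct.Closure.Reflexive using ([_]; refl)
  open import Relation.Binary.Construct.Closure.ReflexiveTransitive using (Star; ε; _◅_)
  open import Relation.Binary.PropositionalEquality hiding ([_]) renaming (refl to ≡-refl)
  open FiniteGame using (Win; step; module Vectors)
  open SubsetCounting
  open Balls D

  n = suc n′

  -- Lists let `++` split the team into parked and moving cops; pointwise moves preserve the length
  -- and so the number of cops.
  ListWin : List (Fin n) → Fin n → Set
  ListWin = Win (Pointwise (Move D)) (λ L r → r ∈ˡ L) (Move D)

  Guarded : List (Fin n) → Fin n → Set
  Guarded L r = Any (λ g → Move D g r) L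

  stay : ∀ L → Pointwise (Move D) L L
  stay L = PW.refl refl

  caught : ∀ {L r} → r ∈ˡ L → ListWin L r
  caught {L} r∈ = step L (stay L) (inj₁ r∈)

  guarded⇒win : ∀ {L r} → Guarded L r → ListWin L r
  guarded⇒win {r = r} h = let (L′ , moves , r∈) = seize h in step L′ moves (inj₁ r∈)
    where
    seize : ∀ {L} → Guarded L r → ∃[ L′ ] Pointwise (Move D) L L′ × r ∈ˡ L′
    seize {_ ∷ L} (here e)  = r ∷ L , e ∷ stay L , here ≡-refl
    seize {g ∷ L} (there h) = let (L′ , moves , r∈) = seize h in g ∷ L′ , refl ∷ moves , there r∈

  stopped : ∀ {xs ys} → Pointwise (Walk 0) xs ys → xs ≡ ys
  stopped []            = ≡-refl
  stopped (stop ∷ ws) = cong (_ ∷_) (stopped ws)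

  firstStep : ∀ {m xs ys} → Pointwise (Walk (suc m)) xs ys →
              ∃[ zs ] Pointwise (Move D) xs zs × Pointwise (Walk m) zs ys
  firstStep []             = [] , [] , []
  firstStep ((e ∷ w) ∷ ws) = let (zs , es , ws′) = firstStep ws in _ ∷ zs , e ∷ es , w ∷ ws′

  -- `I j` confines the robber after `j` moves. If he breaks out, he stands within reach of a parked
  -- cop and is caught at the next move; otherwise the walkers complete their journey.
  travel : ∀ m {G xs ys} (I : ℕ → Fin n → Set) →
           (∀ j {r r′} → I j r → Move D r r′ → I (suc j) r′ ⊎ Guarded G r′) →
           Pointwise (Walk m) xs ys → (∀ {r} → I m r → ListWin (G ++ ys) r) →
           ∀ {r} → I 0 r → ListWin (G ++ xs) r
  travel zero    I inv ws goal i rewrite stopped ws = goal i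
  travel (suc m) {G} I inv ws goal {r} i = let (zs , es , ws′) = firstStep ws in
    step (G ++ zs) (PW.++⁺ (stay G) es) (inj₂ λ r′ e → continue ws′ (inv 0 i e))
    where
    continue : ∀ {zs r′} → Pointwise (Walk m) zs _ → I 1 r′ ⊎ Guarded G r′ → ListWin (G ++ zs) r′
    continue ws′ (inj₁ i′)  = travel m (λ j → I (suc j)) (λ j → inv (suc j)) ws′ goal i′
    continue ws′ (inj₂ h)   = guarded⇒win (Anyₚ.++⁺ˡ h)

  module _ (sc : StronglyConnected D) where

    star⇒walk : ∀ {u v} → Star (Digraph._⟶_ D) u v → ∃[ m ] Walk m u v
    star⇒walk ε        = 0 , stop
    star⇒walk (e ◅ es) = let (m , w) = star⇒walk es in suc m , [ e ] ∷ w

    connect : ∀ xs ys → length xs ≡ length ys → ∃[ m ] Pointwise (Walk m) xs ys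
    connect []       []       _  = 0 , []
    connect (x ∷ xs) (y ∷ ys) eq =
      let (m , w) = star⇒walk (sc x y); (m′ , ws) = connect xs ys (suc-injective eq) in
      m ⊔ m′ , walk-≤ (m≤m⊔n m m′) w ∷ PW.map (walk-≤ (m≤n⊔m m m′)) ws

    Closed : Subset n → List (Fin n) → Set
    Closed T G = ∀ {r r′} → r ∈ T → Move D r r′ → r′ ∈ T ⊎ Guarded G r′

    -- Strong connectivity gives walks of some unknown length; meanwhile `Closed` holds the robber
    -- in `T` or exposes him to a guard.
    relocate : ∀ {T G xs ys} → Closed T G → length xs ≡ length ys →
               (∀ {r} → r ∈ T → ListWin (G ++ ys) r) → ∀ {r} → r ∈ T → ListWin (G ++ xs) r
    relocate {T} {xs = xs} {ys} closed eq goal =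
      let (m , ws) = connect xs ys eq in travel m (λ _ → _∈ T) (λ _ → closed) ws goal

    -- Surplus cops go to the arbitrary vertex `zero`, so that the target list is as long as the
    -- list of movers.
    fill : ℕ → List (Fin n) → List (Fin n)
    fill l zs = zs ++ replicate (l ∸ length zs) zero

    length-fill : ∀ {l} zs → length zs ≤ l → length (fill l zs) ≡ l
    length-fill {l} zs h = trans (length-++ zs)
      (trans (cong (length zs +_) (length-replicate (l ∸ length zs))) (m+[n∸m]≡n h))

    -- At most `g` cops get parked, at least `m` stay free. `cover` and `families` let `b` blocks of
    -- `q` picks hit all private sets, `balls` lets `J` stages serve an out-ball, `growth` is (1 +
    -- 1/K)^t ≥ 2k, and by `copies` and `flood` the free cops can form all crews or fill the inside
    -- of a thin in-ball.
    module Hunt (K t k J q b g m : ℕ) .{{_ : NonZero k}}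
      (cover    : n ≤ q * k)
      (families : n * K ^ t < 2 ^ b)
      (balls    : K ^ t < 2 ^ J)
      (growth   : 2 * k * K ^ t ≤ suc K ^ t)
      (capacity : ∀ l → K * l ≤ n → l ≤ g)
      (copies   : J * (b * q) ≤ m)
      (flood    : 2 * k * K ^ t ≤ m) where

      module Terminal (T : Subset n) (deg : ∀ {x} → x ∈ T → ∣ outNbhd T x ∣ ≤ K)
                      (expanding : Assignment.Expanding T t k (K ^ t)) where
        open Assignment T t k using (Stages; stages; Serves)
        open Hitting {n′} k using (Large; hitting)

        stagesAt : ∀ {r} → r ∈ T → Stages J (outBall T r t)
        stagesAt {r} r∈T = stages expanding J (outBall T r t) (outBall⊆T T r∈T t)
          (∣outBall∣≤ T deg r∈T t) (≤-<-trans (∣outBall∣≤ T deg r∈T t) balls)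

        setsAt : ∀ {r} → Dec (r ∈ T) → List (Subset n)
        setsAt (yes r∈T) = Stages.sets (stagesAt r∈T)
        setsAt (no _)    = []

        length-setsAt : ∀ {r} (d : Dec (r ∈ T)) → length (setsAt d) ≤ K ^ t
        length-setsAt (yes r∈T) = ≤-trans (Stages.few (stagesAt r∈T)) (∣outBall∣≤ T deg r∈T t)
        length-setsAt (no _)    = z≤n

        large-setsAt : ∀ {r} (d : Dec (r ∈ T)) → Large (setsAt d)
        large-setsAt (yes r∈T) = Stages.large (stagesAt r∈T)
        large-setsAt (no _)    = []

        family : List (Fin n) → List (Subset n)
        family = concatMap λ r → setsAt (r ∈? T)

        length-family : ∀ rs → length (family rs) ≤ length rs * K ^ t
        length-family []       = z≤n
        length-family (r ∷ rs) = ≤-trans (≤-reflexive (length-++ (setsAt (r ∈? T))))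
          (+-mono-≤ (length-setsAt (r ∈? T)) (length-family rs))

        large-family : ∀ rs → Large (family rs)
        large-family []       = []
        large-family (r ∷ rs) = Allₚ.++⁺ (large-setsAt (r ∈? T)) (large-family rs)

        -- Taken over all vertices at once, because the robber still moves about in `T` while the
        -- posts are being manned.
        posts : ∃[ S ] length S ≡ b * q × (∀ {M} → M ∈ˡ family (allFin n) → Any (_∈ M) S)
        posts = hitting q cover b (family (allFin n)) (large-family (allFin n))
          (≤-<-trans (length-family (allFin n))
            (subst (λ l → l * K ^ t < 2 ^ b) (sym (length-tabulate {n = n} (λ i → i))) families))

        S = proj₁ posts

        -- `family` uses the membership proof returned by `r ∈? T`, which may differ from the given
        -- one; so the stages built from it are returned along with the hitting property.
        hitStages : ∀ {r} → r ∈ T → ∃[ St ] (∀ {M} → M ∈ˡ Stages.sets {J} {outBall T r t} St → Any (_∈ M) S)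
        hitStages {r} r∈T = go (r ∈? T) ≡-refl
          where
          go : (d : Dec (r ∈ T)) → (r ∈? T) ≡ d →
               ∃[ St ] (∀ {M} → M ∈ˡ Stages.sets {J} {outBall T r t} St → Any (_∈ M) S)
          go (yes r∈) eq = stagesAt r∈ , λ M∈ → proj₂ (proj₂ posts)
            (∈-concatMap⁺ (λ r → setsAt (r ∈? T)) (lose (∈-allFin r) (subst (λ d → _ ∈ˡ setsAt d) (sym eq) M∈)))
          go (no r∉) _ = ⊥-elim (r∉ r∈T)

        -- One copy of the posts per stage: a vertex may lie in private sets of several stages, with
        -- different destinations.
        crew : ℕ → List (Fin n)
        crew j = concat (replicate j S)

        length-crew : ∀ j → length (crew j) ≡ j * length S
        length-crew zero    = ≡-refl
        length-crew (suc j) = trans (length-++ S) (cong (length S +_) (length-crew j))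

        sent : List (Fin n → Fin n) → List (Fin n)
        sent = concatMap λ dest → map dest S

        crew-walks : ∀ {dests} → All (λ dest → ∀ s → Walk t s (dest s)) dests →
                     Pointwise (Walk t) (crew (length dests)) (sent dests)
        crew-walks []       = []
        crew-walks (w ∷ ws) = PW.++⁺ (single S) (crew-walks ws)
          where
          single : ∀ xs → Pointwise (Walk t) xs (map _ xs)
          single []       = []
          single (x ∷ xs) = w x ∷ single xs

        sent-∈ : ∀ {dests dest M v} → dest ∈ˡ dests → Any (_∈ M) S → Serves dest M v → v ∈ˡ sent dests
        sent-∈ {dests} {dest} d∈ hit serves =
          ∈-concatMap⁺ (λ dest → map dest S) (lose d∈ (arrives hit))
          where
          arrives : ∀ {xs} → Any (_∈ _) xs → _ ∈ˡ map dest xs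
          arrives (here s∈)  = here (sym (serves s∈))
          arrives (there h) = there (arrives h)

        -- The robber's present vertex fixes the stages, and each crew follows its `dest` for `t`
        -- moves. Wherever he then stands, some cop started in the private set of that vertex and
        -- was sent to it.
        ambush : ∀ {G} ps → Closed T G → ∀ {r} → r ∈ T → ListWin (G ++ crew J ++ ps) r
        ambush {G} ps closed {r} r∈T with hitStages r∈T
        ... | St , hit = travel t (λ j → _∈ outBall T r j) inv walks′ arrive (x∈⁅x⁆ r)
          where
          open Stages St
          inv : ∀ j {x y} → x ∈ outBall T r j → Move D x y → y ∈ outBall T r (suc j) ⊎ Guarded G y
          inv j x∈ e with closed (outBall⊆T T r∈T j x∈) e
          ... | inj₁ y∈T = inj₁ (outBall-move T j x∈ y∈T e)
          ... | inj₂ h   = inj₂ h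
          walks′ : Pointwise (Walk t) (crew J ++ ps) (sent dests ++ ps)
          walks′ = PW.++⁺ (subst (λ j → Pointwise (Walk t) (crew j) (sent dests)) count (crew-walks walks))
                          (PW.refl (wait t _))
          arrive : ∀ {v} → v ∈ outBall T r t → ListWin (G ++ sent dests ++ ps) v
          arrive v∈ with served v∈
          ... | dest , d∈ , M , M∈ , serves = caught (∈-++⁺ʳ G (∈-++⁺ˡ (sent-∈ d∈ (hit M∈) serves)))

        finish : ∀ {G} xs → Closed T G → m ≤ length xs → ∀ {r} → r ∈ T → ListWin (G ++ xs) r
        finish xs closed m≤ = relocate closed (sym (length-fill (crew J) enough)) (ambush _ closed)
          where
          enough : length (crew J) ≤ length xs
          enough = ≤-trans (≤-reflexive (trans (length-crew J) (cong (J *_) (proj₁ (proj₂ posts))))) (≤-trans copies m≤)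

      -- `paid` is an amortised account: each parked cop is paid for by `K` removed vertices, so
      -- `capacity` keeps their number within `g`.
      record State (T : Subset n) (G xs : List (Fin n)) : Set where
        constructor state
        field
          closed : Closed T G
          paid   : K * length G + ∣ T ∣ ≤ n
          total  : length G + length xs ≡ g + m

      mobile : ∀ {T G xs} → State T G xs → m ≤ length xs
      mobile {T} {G} {xs} (state _ paid total) = +-cancelˡ-≤ (length G) m (length xs) (begin
        length G + m            ≤⟨ +-monoˡ-≤ m (capacity (length G) (≤-trans (m≤m+n _ ∣ T ∣) paid)) ⟩
        g + m                   ≡⟨ sym total ⟩
        length G + length xs    ∎)
        where open ≤-Reasoning

      Cleared : Subset n → Set
      Cleared T = ∀ {G xs} → State T G xs → ∀ {r} → r ∈ T → ListWin (G ++ xs) r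

      -- The cops take their posts while `T` is still closed. If the robber is then in `R`,
      -- `trapped` catches him. Otherwise `gs` stay parked, `sep` makes `T ─ R` closed, and `fs` are
      -- free again.
      remove : ∀ {T R} (gs fs : List (Fin n)) → R ⊆ T → K * length gs ≤ ∣ R ∣ → length fs ≤ m →
               (∀ {r} → r ∈ R → Guarded (gs ++ fs) r) →
               (∀ {r r′} → r ∈ T ─ R → Move D r r′ → r′ ∈ R → Guarded gs r′) →
               Cleared (T ─ R) → Cleared T
      remove {T} {R} gs fs R⊆T cost fs≤m trapped sep cleared {G} {xs} (state closed paid total) =
        relocate closed (sym (length-fill (gs ++ fs) fits)) goal
        where
        open ≤-Reasoning
        ps = replicate (length xs ∸ length (gs ++ fs)) zero
        paid′ : K * length (G ++ gs) + ∣ T ─ R ∣ ≤ n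
        paid′ = begin
          K * length (G ++ gs) + ∣ T ─ R ∣            ≡⟨ cong (λ l → K * l + ∣ T ─ R ∣) (length-++ G) ⟩
          K * (length G + length gs) + ∣ T ─ R ∣      ≡⟨ cong (_+ ∣ T ─ R ∣) (*-distribˡ-+ K (length G) (length gs)) ⟩
          K * length G + K * length gs + ∣ T ─ R ∣    ≤⟨ +-monoˡ-≤ ∣ T ─ R ∣ (+-monoʳ-≤ (K * length G) cost) ⟩
          K * length G + ∣ R ∣ + ∣ T ─ R ∣            ≡⟨ +-assoc (K * length G) ∣ R ∣ ∣ T ─ R ∣ ⟩
          K * length G + (∣ R ∣ + ∣ T ─ R ∣)          ≡⟨ cong (K * length G +_) (trans (+-comm ∣ R ∣ ∣ T ─ R ∣) (∣p─q∣+∣q∣≡∣p∣ T R R⊆T)) ⟩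
          K * length G + ∣ T ∣                        ≤⟨ paid ⟩
          n                                           ∎
        guards≤g : length (G ++ gs) ≤ g
        guards≤g = capacity _ (≤-trans (m≤m+n _ _) paid′)
        fits : length (gs ++ fs) ≤ length xs
        fits = +-cancelˡ-≤ (length G) _ _ (begin
          length G + length (gs ++ fs)          ≡⟨ cong (length G +_) (length-++ gs) ⟩
          length G + (length gs + length fs)    ≡⟨ sym (+-assoc (length G) _ _) ⟩
          length G + length gs + length fs      ≡⟨ cong (_+ length fs) (sym (length-++ G)) ⟩
          length (G ++ gs) + length fs          ≤⟨ +-mono-≤ guards≤g fs≤m ⟩
          g + m                                 ≡⟨ sym total ⟩
          length G + length xs                  ∎)
        regroup : G ++ (gs ++ fs) ++ ps ≡ (G ++ gs) ++ fs ++ ps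
        regroup = trans (cong (G ++_) (++-assoc gs fs ps)) (sym (++-assoc G gs (fs ++ ps)))
        total′ : length (G ++ gs) + length (fs ++ ps) ≡ g + m
        total′ = trans (sym (length-++ (G ++ gs))) (trans (cong length (sym regroup))
          (trans (length-++ G) (trans (cong (length G +_) (length-fill (gs ++ fs) fits)) total)))
        closed′ : Closed (T ─ R) (G ++ gs)
        closed′ {r} {r′} r∈ e with closed (proj₁ (x∈p─q⁻ T R r∈)) e
        ... | inj₂ h = inj₂ (Anyₚ.++⁺ˡ h)
        ... | inj₁ r′∈T with r′ ∈? R
        ...   | yes r′∈R = inj₂ (Anyₚ.++⁺ʳ G (sep r∈ e r′∈R))
        ...   | no r′∉R  = inj₁ (x∈p∧x∉q⇒x∈p─q r′∈T r′∉R)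
        goal : ∀ {r} → r ∈ T → ListWin (G ++ fill (length xs) (gs ++ fs)) r
        goal {r} r∈T with r ∈? R
        ... | yes r∈R = guarded⇒win (Anyₚ.++⁺ʳ G (Anyₚ.++⁺ˡ (trapped r∈R)))
        ... | no r∉R  = subst (λ L → ListWin L r) (sym regroup)
          (cleared (state closed′ paid′ total′) (x∈p∧x∉q⇒x∈p─q r∈T r∉R))

      shrinks : ∀ (T R : Subset n) {x} → x ∈ T → x ∈ R → ∣ T ─ R ∣ < ∣ T ∣
      shrinks T R x∈T x∈R = p∩q≢∅⇒∣p─q∣<∣p∣ T R (_ , x∈p∩q⁺ (x∈T , x∈R))

      HighDegree : Subset n → Fin n → Set
      HighDegree T x = x ∈ T × K < ∣ outNbhd T x ∣

      -- A single cop at `x` dominates the removed set, whose more than `K` vertices pay for it.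
      removeHighDegree : ∀ {T x} → HighDegree T x → Cleared (T ─ outNbhd T x) → Cleared T
      removeHighDegree {T} {x} (x∈T , high) = remove (x ∷ []) []
        (λ y∈ → proj₁ (∈-outNbhd⁻ T y∈)) (≤-trans (≤-reflexive (*-identityʳ K)) (<⇒≤ high)) z≤n
        (λ y∈ → here (proj₂ (∈-outNbhd⁻ T y∈))) (λ _ _ y∈ → here (proj₂ (∈-outNbhd⁻ T y∈)))

      Narrow : Subset n → Subset n → Set
      Narrow T A = A ⊆ T × ∣ A ∣ ≤ K ^ t × ∣ inBall T A t ∣ < 2 * k * ∣ A ∣

      narrow? : ∀ T A → Dec (Narrow T A)
      narrow? T A = (A ⊆? T) ×-dec ((∣ A ∣ ≤? K ^ t) ×-dec (∣ inBall T A t ∣ <? 2 * k * ∣ A ∣))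

      -- Fast growth at every radius would give the in-ball at least (1 + 1/K)^t |A| ≥ 2k |A|
      -- vertices, against narrowness.
      thinBoundary : ∀ {T A} → Narrow T A →
        ∃[ j ] j < t × K * ∣ boundary T A j ∣ ≤ ∣ inBall T A j ∣
      thinBoundary {T} {A} (_ , A≤ , small) with slowGrowth T K t A
      ... | inj₁ found = found
      ... | inj₂ grown = ⊥-elim (<-irrefl ≡-refl (begin-strict
          K ^ t * ∣ inBall T A t ∣       <⟨ *-monoʳ-< (K ^ t) {{>-nonZero K^t>0}} small ⟩
          K ^ t * (2 * k * ∣ A ∣)        ≡⟨ trans (sym (*-assoc (K ^ t) (2 * k) ∣ A ∣)) (cong (_* ∣ A ∣) (*-comm (K ^ t) (2 * k))) ⟩
          2 * k * K ^ t * ∣ A ∣          ≤⟨ *-monoˡ-≤ ∣ A ∣ growth ⟩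
          suc K ^ t * ∣ A ∣              ≤⟨ grown ⟩
          K ^ t * ∣ inBall T A t ∣       ∎))
        where
        open ≤-Reasoning
        K^t>0 : 0 < K ^ t
        K^t>0 = ≤-trans (n≢0⇒n>0 λ A≡0 → n≮0 (subst (∣ inBall T A t ∣ <_) (trans (cong (2 * k *_) A≡0) (*-zeroʳ (2 * k))) small)) A≤

      -- The boundary stays occupied and is charged to the inside by `thin`; the inside is occupied
      -- only until the robber is known to be elsewhere, and narrowness bounds it by `m`.
      removeNarrow : ∀ {T A j} → Narrow T A → j < t → K * ∣ boundary T A j ∣ ≤ ∣ inBall T A j ∣ →
                     Cleared (T ─ inBall T A (suc j)) → Cleared T
      removeNarrow {T} {A} {j} (A⊆T , A≤ , small) j<t thin = remove (elements ∂) (elements B)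
        (inBall⊆T T A⊆T (suc j))
        (≤-trans (≤-trans (≤-reflexive (cong (K *_) (length-elements ∂))) thin) (p⊆q⇒∣p∣≤∣q∣ (inBall-suc T A j)))
        (≤-trans (≤-reflexive (length-elements B)) (begin
          ∣ B ∣                ≤⟨ p⊆q⇒∣p∣≤∣q∣ (inBall-mono-≤ T A (<⇒≤ j<t)) ⟩
          ∣ inBall T A t ∣     ≤⟨ <⇒≤ small ⟩
          2 * k * ∣ A ∣        ≤⟨ *-monoʳ-≤ (2 * k) A≤ ⟩
          2 * k * K ^ t        ≤⟨ flood ⟩
          m                    ∎))
        (λ r∈ → Sum.[ (λ r∈B → Anyₚ.++⁺ʳ (elements ∂) (occupied r∈B)) , (λ r∈∂ → Anyₚ.++⁺ˡ (occupied r∈∂)) ]′ (split r∈))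
        (λ r∈ e r′∈ → Sum.[ (λ r′∈B → ⊥-elim (noEntry r∈ e r′∈B)) , occupied ]′ (split r′∈))
        where
        open ≤-Reasoning
        B = inBall T A j
        ∂ = boundary T A j
        occupied : ∀ {p : Subset n} {r} → r ∈ p → Guarded (elements p) r
        occupied r∈ = Any.map (λ { ≡-refl → refl }) (∈-elements⁺ r∈)
        split : ∀ {r} → r ∈ inBall T A (suc j) → r ∈ B ⊎ r ∈ ∂
        split {r} r∈ with r ∈? B
        ... | yes r∈B = inj₁ r∈B
        ... | no r∉B  = inj₂ (x∈p∧x∉q⇒x∈p─q r∈ r∉B)
        -- A vertex of `T` with a move into `B` already lies in the next in-ball, so the removed set
        -- can only be entered through its boundary.
        noEntry : ∀ {r r′} → r ∈ T ─ inBall T A (suc j) → Move D r r′ → r′ ∉ B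
        noEntry r∈ e r′∈B = let (r∈T , r∉) = x∈p─q⁻ T (inBall T A (suc j)) r∈ in r∉ (inBall-step T j r′∈B r∈T e)

      narrow-nonempty : ∀ {T A} → Narrow T A → Nonempty A
      narrow-nonempty {T} {A} (_ , _ , small) with nonempty? A
      ... | yes ne = ne
      ... | no e   = ⊥-elim (n≮0 (subst (∣ inBall T A t ∣ <_)
              (trans (cong (2 * k *_) (trans (cong ∣_∣ (Empty-unique e)) (∣⊥∣≡0 n))) (*-zeroʳ (2 * k))) small))

      clearTerminal : ∀ {T} → (∀ {x} → x ∈ T → ∣ outNbhd T x ∣ ≤ K) →
                      Assignment.Expanding T t k (K ^ t) → Cleared T
      clearTerminal {T} deg expanding {xs = xs} st =
        Terminal.finish T deg expanding xs (State.closed st) (mobile st)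

      -- Both reductions remove a nonempty part of `T`, so `fuel` above its size suffices. When
      -- neither applies, the two failed searches are exactly the hypotheses of the terminal case.
      clear : ∀ fuel T → ∣ T ∣ < fuel → Cleared T
      clear (suc fuel) T T< with any? (λ x → (x ∈? T) ×-dec (K <? ∣ outNbhd T x ∣))
      ... | yes (x , hd@(x∈T , _)) = removeHighDegree hd
              (clear fuel (T ─ outNbhd T x) (<-≤-trans (shrinks T (outNbhd T x) x∈T (∈-outNbhd⁺ T x∈T refl)) (s≤s⁻¹ T<)))
      ... | no lowDegree with anySubset? (narrow? T)
      ...   | yes (A , na@(A⊆T , _)) = let (x , x∈A) = narrow-nonempty na ; (j , j<t , thin) = thinBoundary na in
              removeNarrow {j = j} na j<t thin (clear fuel (T ─ inBall T A (suc j))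
                (<-≤-trans (shrinks T (inBall T A (suc j)) (A⊆T x∈A) (inBall-mono-≤ T A {j = suc j} z≤n x∈A)) (s≤s⁻¹ T<)))
      ...   | no wide = clearTerminal
              (λ {x} x∈T → ≮⇒≥ λ K< → lowDegree (x , x∈T , K<))
              (λ A A⊆T A≤ → ≮⇒≥ λ small → wide (A , A⊆T , A≤ , small))

      listWin : ∀ r → ListWin (replicate (g + m) zero) r
      listWin r = clear (suc n) full (s≤s (∣p∣≤n full)) {G = []} (state
          (λ _ _ → inj₁ ∈⊤)
          (≤-trans (≤-reflexive (cong (_+ ∣ full {n} ∣) (*-zeroʳ K))) (∣p∣≤n (full {n})))
          (length-replicate (g + m))) ∈⊤

  module _ (k : ℕ) where
    open Vectors D k

    place : ∀ L → length L ≡ k → Fin k → Fin n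
    place L len i = lookup L (cast (sym len) i)

    At : Fin (n ^ k) → (L : List (Fin n)) → length L ≡ k → Set
    At p L len = ∀ i → finToFun p i ≡ place L len i

    at-move : ∀ {L L′ p p′} (len : length L ≡ k) (len′ : length L′ ≡ k) → At p L len → At p′ L′ len′ →
              Pointwise (Move D) L L′ → Legal p p′
    at-move {L} {L′} len len′ p≡ p′≡ moves i = subst₂ (Move D) (sym (p≡ i))
      (trans (cong (lookup L′) (cast-trans (sym len) (Pointwise-length moves) i)) (sym (p′≡ i)))
      (PW.lookup⁺ moves (cast (sym len) i))

    at-caught : ∀ {L p r} (len : length L ≡ k) → At p L len → r ∈ˡ L → Caught p r
    at-caught {L} len p≡ r∈ = cast len (index r∈) , trans (p≡ _)
      (trans (cong (lookup L) (trans (cast-trans len (sym len) (index r∈)) (cast-is-id ≡-refl (index r∈))))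
             (sym (Anyₚ.lookup-index r∈)))

    toVector : ∀ {L r} → ListWin L r → (len : length L ≡ k) → ∀ p → At p L len → W p r
    toVector (step L′ moves end) len p p≡ with trans (sym (Pointwise-length moves)) len
    toVector (step L′ moves (inj₁ r∈)) len p p≡ | len′ =
      step p′ (at-move len len′ p≡ p′≡ moves) (inj₁ (at-caught len′ p′≡ r∈))
      where
      p′ = funToFin (place L′ len′)
      p′≡ = finToFun-funToFin (place L′ len′)
    toVector (step L′ moves (inj₂ f)) len p p≡ | len′ =
      step p′ (at-move len len′ p≡ p′≡ moves) (inj₂ λ r′ e → toVector (f r′ e) len′ p′ p′≡)
      where
      p′ = funToFin (place L′ len′)
      p′≡ = finToFun-funToFin (place L′ len′)

    listWin⇒CopsWin : ∀ L → length L ≡ k → (∀ r → ListWin L r) → CopsWin D k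
    listWin⇒CopsWin L len w = win⇒CopsWin (funToFin (place L len))
      λ r → toVector (w r) len _ (finToFun-funToFin (place L len))

-- Choice of the parameters

module Parameters where
  open import Data.Nat
  open import Data.Nat.Properties
  open import Data.Nat.DivMod using (_/_; _%_; m/n*n≤m; m≡m%n+[m/n]*n; m%n<n; m≥n⇒m/n>0; /-mono-≤; m*n/n≡m)
  open import Data.Nat.Tactic.RingSolver using (solve-∀)
  open import Data.Product using (_×_; _,_; ∃-syntax)
  open import Data.Sum using (_⊎_; [_,_]′)
  open import Relation.Nullary using (yes; no)
  open import Relation.Binary.PropositionalEquality hiding (J)
  open PowerBounds
  open ≤-Reasoning

  log₂ : ∀ n → 0 < n → ∃[ l ] 2 ^ l ≤ n × n < 2 ^ suc l
  log₂ (suc zero)    _ = 0 , ≤-refl , n<1+n 1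
  log₂ (suc (suc n)) _ with log₂ (suc n) (s≤s z≤n)
  ... | l , lo , hi with suc (suc n) <? 2 ^ suc l
  ...   | yes h = l , m≤n⇒m≤1+n lo , h
  ...   | no ¬h = suc l , ≮⇒≥ ¬h , (begin-strict
    suc (suc n)            ≤⟨ hi ⟩
    2 ^ suc l              <⟨ ^-monoʳ-< 2 (n<1+n 1) (n<1+n (suc l)) ⟩
    2 ^ suc (suc l)        ∎)

  log₂-≥ : ∀ E n → 2 ^ E ≤ n → ∃[ l ] E ≤ l × 2 ^ l ≤ n × n < 2 ^ suc l
  log₂-≥ E n h with log₂ n (<-≤-trans (m^n>0 2 E) h)
  ... | l , lo , hi = l , ≮⇒≥ (λ l<E → <⇒≱ hi (≤-trans (^-monoʳ-≤ 2 l<E) h)) , lo , hi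

  -- For μ = 12 + e this is 10 μ² ≤ 2^(μ - 1), which fails at μ = 11; hence the threshold 2^11 for
  -- `l`. From μ to μ + 1 the right side doubles and the left less than doubles.
  quadratic≤2^ : ∀ e → 10 * ((12 + e) * (12 + e)) ≤ 2 ^ (11 + e)
  quadratic≤2^ zero    = ≤ᵇ⇒≤ 1440 2048 _
  quadratic≤2^ (suc e) = begin
    10 * ((12 + suc e) * (12 + suc e))       ≡⟨ lem e ⟩
    10 * ((13 + e) * (13 + e))               ≤⟨ m≤m+n _ (10 * (119 + 22 * e + e * e)) ⟩
    10 * ((13 + e) * (13 + e)) + 10 * (119 + 22 * e + e * e) ≡⟨ lem₂ e ⟩
    2 * (10 * ((12 + e) * (12 + e)))         ≤⟨ *-monoʳ-≤ 2 (quadratic≤2^ e) ⟩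
    2 * 2 ^ (11 + e)                         ≡⟨ cong (2 ^_) (sym (+-suc 11 e)) ⟩
    2 ^ (11 + suc e)                         ∎
    where
    lem : ∀ e → 10 * ((12 + (1 + e)) * (12 + (1 + e))) ≡ 10 * ((13 + e) * (13 + e))
    lem = solve-∀
    lem₂ : ∀ e → 10 * ((13 + e) * (13 + e)) + 10 * (119 + 22 * e + e * e) ≡ 2 * (10 * ((12 + e) * (12 + e)))
    lem₂ = solve-∀

  n<3^n : ∀ n → n < 3 ^ n
  n<3^n zero    = s≤s z≤n
  n<3^n (suc n) = begin-strict
    suc n       ≤⟨ n<3^n n ⟩
    3 ^ n       <⟨ ^-monoʳ-< 3 (s≤s (s≤s z≤n)) (n<1+n n) ⟩
    3 ^ suc n   ∎

  2K^K≤[1+K]^K : ∀ K .{{_ : NonZero K}} → 2 * K ^ K ≤ suc K ^ K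
  2K^K≤[1+K]^K K = *-cancelˡ-≤ K (begin
    K * (2 * K ^ K)       ≡⟨ lem K (K ^ K) ⟩
    K ^ K * (K + K * 1)   ≤⟨ bernoulli K 1 K ⟩
    K * (K + 1) ^ K       ≡⟨ cong (λ z → K * z ^ K) (+-comm K 1) ⟩
    K * suc K ^ K         ∎)
    where
    lem : ∀ K x → K * (2 * x) ≡ x * (K + K * 1)
    lem = solve-∀

  -- l stands for ⌊log₂ n⌋ and μ for ⌊log₂ l⌋ + 1
  module Choice (n l μ : ℕ) .{{_ : NonZero μ}} (2^l≤n : 2 ^ l ≤ n) (n<2^[1+l] : n < 2 ^ suc l)
                (l<2^μ : l < 2 ^ μ) (10μ²≤l : 10 * (μ * μ) ≤ l) (12μ≤l : 12 * μ ≤ l) where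

    d : ℕ
    d = 10 * (μ * μ)

    instance
      d≢0 : NonZero d
      d≢0 = m*n≢0 10 (μ * μ) {{_}} {{m*n≢0 μ μ}}

    -- `t` makes (1 + 1/K)^t ≥ 2^(5μ) ≥ 2k. As K ≤ 2^μ, K^t ≤ 2^(5Kμ²), which `d` keeps within
    -- 2^(l/2). Since K and J are at most 2^μ and b is at most 2^(2μ), the exponent 4μ of `k`
    -- absorbs `K * (J * b)`.
    K k t J b q g m : ℕ
    K = l / d
    k = 2 ^ (4 * μ)
    t = K * (5 * μ)
    J = suc l
    b = suc (2 * l)
    q = suc (n / k) where instance _ = m^n≢0 2 (4 * μ)

    K>0 : 0 < K
    K>0 = m≥n⇒m/n>0 10μ²≤l

    instance
      K≢0 : NonZero K
      K≢0 = >-nonZero K>0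
      k≢0 : NonZero k
      k≢0 = m^n≢0 2 (4 * μ)

    g = n / K
    m = J * (b * q) + 2 * k * K ^ t

    K*d≤l : K * d ≤ l
    K*d≤l = m/n*n≤m l d

    K≤l : K ≤ l
    K≤l = ≤-trans (m≤m*n K d) K*d≤l

    K≤2^μ : K ≤ 2 ^ μ
    K≤2^μ = ≤-trans K≤l (<⇒≤ l<2^μ)

    K^t≤ : K ^ t ≤ 2 ^ (μ * t)
    K^t≤ = ≤-trans (^-monoˡ-≤ t K≤2^μ) (≤-reflexive (^-*-assoc 2 μ t))

    2μt≤l : 2 * (μ * t) ≤ l
    2μt≤l = ≤-trans (≤-reflexive (lem K μ)) K*d≤l
      where
      lem : ∀ K μ → 2 * (μ * (K * (5 * μ))) ≡ K * (10 * (μ * μ))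
      lem = solve-∀

    μt≤l : μ * t ≤ l
    μt≤l = ≤-trans (m≤m+n (μ * t) _) 2μt≤l

    cover : n ≤ q * k
    cover = begin
      n                      ≡⟨ m≡m%n+[m/n]*n n k ⟩
      n % k + n / k * k      ≤⟨ +-monoˡ-≤ (n / k * k) (<⇒≤ (m%n<n n k)) ⟩
      q * k                  ∎

    families : n * K ^ t < 2 ^ b
    families = begin-strict
      n * K ^ t              <⟨ *-monoˡ-< (K ^ t) {{m^n≢0 K t}} n<2^[1+l] ⟩
      2 ^ suc l * K ^ t      ≤⟨ *-monoʳ-≤ (2 ^ suc l) (≤-trans K^t≤ (^-monoʳ-≤ 2 μt≤l)) ⟩
      2 ^ suc l * 2 ^ l      ≡⟨ sym (^-distribˡ-+-* 2 (suc l) l) ⟩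
      2 ^ (suc l + l)        ≡⟨ cong (λ z → 2 ^ suc z) (cong (l +_) (sym (+-identityʳ l))) ⟩
      2 ^ b                  ∎

    balls : K ^ t < 2 ^ J
    balls = ≤-<-trans (≤-trans K^t≤ (^-monoʳ-≤ 2 μt≤l)) (^-monoʳ-< 2 (n<1+n 1) (n<1+n l))

    2k≤ : 2 * k ≤ 2 ^ (5 * μ)
    2k≤ = ^-monoʳ-≤ 2 {suc (4 * μ)} {5 * μ} (+-monoˡ-≤ (4 * μ) {1} {μ} (>-nonZero⁻¹ μ))

    growth : 2 * k * K ^ t ≤ suc K ^ t
    growth = begin
      2 * k * K ^ t                    ≤⟨ *-monoˡ-≤ (K ^ t) 2k≤ ⟩
      2 ^ (5 * μ) * K ^ t              ≡⟨ cong (2 ^ (5 * μ) *_) (sym (^-*-assoc K K (5 * μ))) ⟩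
      2 ^ (5 * μ) * (K ^ K) ^ (5 * μ)  ≡⟨ sym (^-distribʳ-* (5 * μ) 2 (K ^ K)) ⟩
      (2 * K ^ K) ^ (5 * μ)            ≤⟨ ^-monoˡ-≤ (5 * μ) (2K^K≤[1+K]^K K) ⟩
      (suc K ^ K) ^ (5 * μ)            ≡⟨ ^-*-assoc (suc K) K (5 * μ) ⟩
      suc K ^ t                        ∎

    capacity : ∀ x → K * x ≤ n → x ≤ g
    capacity x h = begin
      x                ≡⟨ sym (m*n/n≡m x K) ⟩
      x * K / K        ≤⟨ /-mono-≤ (≤-trans (≤-reflexive (*-comm x K)) h) (≤-refl {K}) ⟩
      n / K            ∎

    copies : J * (b * q) ≤ m
    copies = m≤m+n _ _

    flood : 2 * k * K ^ t ≤ m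
    flood = m≤n+m _ _

    b≤ : b ≤ 2 * 2 ^ μ
    b≤ = ≤-trans (s≤s (≤-trans (n≤1+n (2 * l)) (≤-reflexive (sym (+-suc l (l + 0)))))) (*-monoʳ-≤ 2 l<2^μ)

    KJb≤k : K * (J * b) ≤ k
    KJb≤k = begin
      K * (J * b)                        ≤⟨ *-mono-≤ K≤2^μ (*-mono-≤ l<2^μ b≤) ⟩
      2 ^ μ * (2 ^ μ * (2 * 2 ^ μ))      ≤⟨ *-monoʳ-≤ (2 ^ μ) (*-monoʳ-≤ (2 ^ μ) (*-monoˡ-≤ (2 ^ μ) (^-monoʳ-≤ 2 {1} {μ} (>-nonZero⁻¹ μ)))) ⟩
      2 ^ μ * (2 ^ μ * (2 ^ μ * 2 ^ μ))  ≡⟨ cong (λ z → 2 ^ μ * (2 ^ μ * z)) (sym (^-distribˡ-+-* 2 μ μ)) ⟩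
      2 ^ μ * (2 ^ μ * 2 ^ (μ + μ))      ≡⟨ cong (2 ^ μ *_) (sym (^-distribˡ-+-* 2 μ (μ + μ))) ⟩
      2 ^ μ * 2 ^ (μ + (μ + μ))          ≡⟨ sym (^-distribˡ-+-* 2 μ (μ + (μ + μ))) ⟩
      2 ^ (μ + (μ + (μ + μ)))            ≡⟨ cong (2 ^_) (lem μ) ⟩
      k                                  ∎
      where
      lem : ∀ μ → μ + (μ + (μ + μ)) ≡ 4 * μ
      lem = solve-∀

    -- `k` absorbs all other factors but `q`; rounding `q` up costs one more `k`, which is at most
    -- 2^l ≤ n.
    hitters : K * (J * (b * q)) ≤ n + n
    hitters = begin
      K * (J * (b * q))      ≡⟨ lem K J b q ⟩
      K * (J * b) * q        ≤⟨ *-monoˡ-≤ q KJb≤k ⟩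
      k * q                  ≡⟨ *-comm k q ⟩
      k + n / k * k          ≤⟨ +-mono-≤ (≤-trans (^-monoʳ-≤ 2 (≤-trans (*-monoˡ-≤ μ {4} {12} (s≤s (s≤s (s≤s (s≤s z≤n))))) 12μ≤l)) 2^l≤n) (m/n*n≤m n k) ⟩
      n + n                  ∎
      where
      lem : ∀ K J b q → K * (J * (b * q)) ≡ K * (J * b) * q
      lem = solve-∀

    -- The exponent of 2 splits into 6μ ≤ l/2 and μt ≤ l/2.
    flooders : K * (2 * k * K ^ t) ≤ n
    flooders = begin
      K * (2 * k * K ^ t)                       ≤⟨ *-mono-≤ K≤2^μ (*-mono-≤ 2k≤ K^t≤) ⟩
      2 ^ μ * (2 ^ (5 * μ) * 2 ^ (μ * t))       ≡⟨ cong (2 ^ μ *_) (sym (^-distribˡ-+-* 2 (5 * μ) (μ * t))) ⟩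
      2 ^ μ * 2 ^ (5 * μ + μ * t)               ≡⟨ sym (^-distribˡ-+-* 2 μ (5 * μ + μ * t)) ⟩
      2 ^ (μ + (5 * μ + μ * t))                 ≤⟨ ^-monoʳ-≤ 2 exponent ⟩
      2 ^ l                                     ≤⟨ 2^l≤n ⟩
      n                                         ∎
      where
      lem : ∀ μ x → 2 * (μ + (5 * μ + x)) ≡ 12 * μ + 2 * x
      lem = solve-∀
      exponent : μ + (5 * μ + μ * t) ≤ l
      exponent = *-cancelˡ-≤ 2 (begin
        2 * (μ + (5 * μ + μ * t))    ≡⟨ lem μ (μ * t) ⟩
        12 * μ + 2 * (μ * t)         ≤⟨ +-mono-≤ 12μ≤l 2μt≤l ⟩
        l + l                        ≡⟨ cong (l +_) (sym (+-identityʳ l)) ⟩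
        2 * l                        ∎)

    cops : ℕ
    cops = g + m

    cops*K≤ : cops * K ≤ 4 * n
    cops*K≤ = begin
      (n / K + m) * K                                       ≡⟨ *-distribʳ-+ K (n / K) m ⟩
      n / K * K + m * K                                     ≤⟨ +-monoˡ-≤ (m * K) (m/n*n≤m n K) ⟩
      n + m * K                                             ≡⟨ cong (n +_) (trans (*-comm m K) (*-distribˡ-+ K (J * (b * q)) (2 * k * K ^ t))) ⟩
      n + (K * (J * (b * q)) + K * (2 * k * K ^ t))         ≤⟨ +-monoʳ-≤ n (+-mono-≤ hitters flooders) ⟩
      n + (n + n + n)                                       ≡⟨ lem n ⟩
      4 * n                                                 ∎
      where
      lem : ∀ n → n + (n + n + n) ≡ 4 * n
      lem = solve-∀

    l≤ : l ≤ 2 * (K * d)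
    l≤ = begin
      l                  ≡⟨ m≡m%n+[m/n]*n l d ⟩
      l % d + K * d      ≤⟨ +-monoˡ-≤ (K * d) (≤-trans (<⇒≤ (m%n<n l d)) (m≤n*m d K)) ⟩
      K * d + K * d      ≡⟨ cong (K * d +_) (sym (+-identityʳ (K * d))) ⟩
      2 * (K * d)        ∎

    -- 80 = 4 · 2 · 10: four shares of n, the rounding in `K = l / d`, and the 10 in `d`.
    cops*l≤ : cops * l ≤ 80 * (n * (μ * μ))
    cops*l≤ = begin
      cops * l                        ≤⟨ *-monoʳ-≤ cops l≤ ⟩
      cops * (2 * (K * d))            ≡⟨ lem cops K (μ * μ) ⟩
      cops * K * (20 * (μ * μ))       ≤⟨ *-monoˡ-≤ (20 * (μ * μ)) cops*K≤ ⟩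
      4 * n * (20 * (μ * μ))          ≡⟨ lem₂ 20 n (μ * μ) ⟩
      80 * (n * (μ * μ))              ∎
      where
      lem : ∀ c K x → c * (2 * (K * (10 * x))) ≡ c * K * (20 * x)
      lem = solve-∀
      lem₂ : ∀ a n x → 4 * n * (a * x) ≡ 4 * a * (n * x)
      lem₂ = solve-∀

  module Estimates (n l e : ℕ) (2^l≤n : 2 ^ l ≤ n) (n<2^[1+l] : n < 2 ^ suc l)
                   (lo : 2 ^ (11 + e) ≤ l) (l<2^μ : l < 2 ^ (12 + e)) where

    10μ²≤l : 10 * ((12 + e) * (12 + e)) ≤ l
    10μ²≤l = ≤-trans (quadratic≤2^ e) lo

    12μ≤l : 12 * (12 + e) ≤ l
    12μ≤l = ≤-trans (*-monoˡ-≤ (12 + e) (m≤m+n 12 e))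
      (≤-trans (m≤n*m ((12 + e) * (12 + e)) 10) 10μ²≤l)

    open Choice n l (12 + e) 2^l≤n n<2^[1+l] l<2^μ 10μ²≤l 12μ≤l public

    private
      μ : ℕ
      μ = 12 + e

    -- v is about half of ⌊log₂ l⌋, so that 4^v < u := 2^(2v+1) and 4^u < n.
    record Estimate : Set where
      field
        u v    : ℕ
        v>0    : 0 < v
        4^v<u  : 4 ^ v < suc u
        4^u<n  : 4 ^ suc u < n
        u≤4p   : suc u ≤ 4 * suc l
        v≤4q   : v ≤ 4 * (4 * suc l)
        bound  : ∀ a {c} → c ≤ cops → c * (a * (4 * suc l)) ≤ a * (8 * (80 * 16)) * n * (v * v)

    4^≡2^ : ∀ x → 4 ^ x ≡ 2 ^ (2 * x)
    4^≡2^ x = ^-*-assoc 2 2 x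

    estimate : Estimate
    estimate = build (half (suc (suc e)))
      where
      build : ∃[ h ] (suc (suc e) ≡ h + h ⊎ suc (suc e) ≡ suc (h + h)) → Estimate
      build (h , parity) = record
        { u = pred u ; v = v ; v>0 = s≤s z≤n
        ; 4^v<u = subst (4 ^ v <_) (sym u≡) (subst (_< u) (sym (4^≡2^ v)) (^-monoʳ-< 2 (n<1+n 1) (n<1+n (2 * v))))
        ; 4^u<n = subst (λ z → 4 ^ z < n) (sym u≡) (<-≤-trans (subst (_< 2 ^ l) (sym (4^≡2^ u)) (^-monoʳ-< 2 (n<1+n 1) 2u<l)) 2^l≤n)
        ; u≤4p = subst (_≤ 4 * suc l) (sym u≡) u≤4p
        ; v≤4q = ≤-trans (≤-trans (<⇒≤ v<u) u≤4p) (m≤n*m (4 * suc l) 4)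
        ; bound = bound }
        where
        v u : ℕ
        -- Here h = ⌊(e + 2)/2⌋. The offset 3 gives both 2u = 2^(8 + 2h) ≤ 2^(10 + e) < l and 4v =
        -- 12 + 4h ≥ μ.
        v = 3 + h
        u = 2 ^ suc (2 * v)
        u≡ : suc (pred u) ≡ u
        u≡ = suc-pred u {{m^n≢0 2 (suc (2 * v))}}
        h+h≤ : h + h ≤ 2 + e
        h+h≤ = [ (λ eq → ≤-reflexive (sym eq)) , (λ eq → ≤-trans (n≤1+n (h + h)) (≤-reflexive (sym eq))) ]′ parity
        ≤h+h : 2 + e ≤ suc (h + h)
        ≤h+h = [ (λ eq → ≤-trans (≤-reflexive eq) (n≤1+n (h + h))) , ≤-reflexive ]′ parity
        2u<l : 2 * u < l
        2u<l = <-≤-trans (^-monoʳ-< 2 (n<1+n 1) {suc (suc (2 * v))} {11 + e} (begin-strict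
            2 + 2 * (3 + h)       ≡⟨ lem h ⟩
            8 + (h + h)           ≤⟨ +-monoʳ-≤ 8 h+h≤ ⟩
            10 + e                <⟨ n<1+n (10 + e) ⟩
            11 + e                ∎)) lo
          where
          lem : ∀ h → 2 + 2 * (3 + h) ≡ 8 + (h + h)
          lem = solve-∀
        u≤4p : u ≤ 4 * suc l
        u≤4p = ≤-trans (m≤n*m u 2) (≤-trans (<⇒≤ 2u<l) (≤-trans (n≤1+n l) (m≤n*m (suc l) 4)))
        v<u : v < u
        v<u = <-trans (<-≤-trans (n<3^n v) (^-monoˡ-≤ v (n≤1+n 3))) (subst (_< u) (sym (4^≡2^ v)) (^-monoʳ-< 2 (n<1+n 1) (n<1+n (2 * v))))
        μ≤4v : μ ≤ 4 * v
        μ≤4v = begin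
          10 + (2 + e)             ≤⟨ +-monoʳ-≤ 10 ≤h+h ⟩
          10 + suc (h + h)         ≤⟨ m≤m+n (10 + suc (h + h)) (1 + 2 * h) ⟩
          10 + suc (h + h) + (1 + 2 * h) ≡⟨ lem h ⟩
          4 * v                    ∎
          where
          lem : ∀ h → 10 + (1 + (h + h)) + (1 + 2 * h) ≡ 4 * (3 + h)
          lem = solve-∀
        -- 8 combines the 4 in the upper bound 4(l + 1) for log n with l + 1 ≤ 2l; 80 comes from
        -- `cops*l≤`, and 16 from squaring μ ≤ 4v.
        bound : ∀ a {c} → c ≤ cops → c * (a * (4 * suc l)) ≤ a * (8 * (80 * 16)) * n * (v * v)
        bound a {c} c≤ = begin
          c * (a * (4 * suc l))            ≤⟨ *-monoʳ-≤ c (*-monoʳ-≤ a (*-monoʳ-≤ 4 1+l≤2l)) ⟩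
          c * (a * (4 * (2 * l)))          ≡⟨ lem c a l ⟩
          a * 8 * (c * l)                  ≤⟨ *-monoʳ-≤ (a * 8) (≤-trans (*-monoˡ-≤ l c≤) cops*l≤) ⟩
          a * 8 * (80 * (n * (μ * μ)))     ≤⟨ *-monoʳ-≤ (a * 8) (*-monoʳ-≤ 80 (*-monoʳ-≤ n (*-mono-≤ μ≤4v μ≤4v))) ⟩
          a * 8 * (80 * (n * (4 * v * (4 * v)))) ≡⟨ lem₂ a 80 n v ⟩
          a * (8 * (80 * 16)) * n * (v * v) ∎
          where
          1+l≤2l : suc l ≤ 2 * l
          1+l≤2l = ≤-trans (+-monoˡ-≤ l (≤-trans (m^n>0 2 (11 + e)) lo)) (≤-reflexive (cong (l +_) (sym (+-identityʳ l))))
          lem : ∀ c a l → c * (a * (4 * (2 * l))) ≡ a * 8 * (c * l)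
          lem = solve-∀
          lem₂ : ∀ a b n v → a * 8 * (b * (n * (4 * v * (4 * v)))) ≡ a * (8 * (b * 16)) * n * (v * v)
          lem₂ = solve-∀

-- The bound on the cop number

module CopNumber where
  open import Data.Nat
  open import Data.Nat.Properties
  open import Data.Fin using (zero)
  open import Data.List using (replicate)
  open import Data.List.Properties using (length-replicate)
  open import Data.Product using (_×_; _,_; ∃-syntax)
  open import Data.Empty using (⊥-elim)
  open import Relation.Binary.PropositionalEquality using (_≡_; refl; sym; subst)
  open CutBounds using (ι; n⟨loglog⟩²/log-≥)
  open Parameters using (log₂-≥; n<3^n; module Estimates)

  Bounded : ℕ → ∀ {n} → Digraph n → Set
  Bounded M {n} D = ∃[ c ] IsCopNumber D c ×
    fromℕ c ≤ᶜ fromℚ (ι M) *ᶜ fromℕ n *ᶜ ((log (log (fromℕ n)) ^ᶜ 2) ÷ᶜ log (fromℕ n))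

  -- The constants are kept as variables, since Agda would compare products
  -- with large literals by unfolding them.
  module _ {M a E : ℕ} (M>0 : 0 < M) (M≡ : M ≡ a * (8 * (80 * 16))) (a≡256 : a ≡ 256) (2^11≤E : 2 ^ 11 ≤ E) where

    bounded : ∀ n′ l e → 2 ^ l ≤ suc n′ → suc n′ < 2 ^ suc l → 2 ^ (11 + e) ≤ l → l < 2 ^ (12 + e) →
              (D : Digraph (suc n′)) → StronglyConnected D → Bounded M D
    bounded n′ l e 2^l≤n n<2^[1+l] lo l<2^μ D sc =
      let (c , isCopNumber , c≤) = FiniteGame.copsWin⇒copNumber D cops win in
      c , isCopNumber , n⟨loglog⟩²/log-≥ M (suc n′) u v l (4 * suc l)
        M>0 v>0 4^v<u 4^u<n (<-≤-trans n<2^[1+l] (^-monoˡ-≤ (suc l) (n≤1+n 2)))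
        (s≤s z≤n) (n<3^n (4 * suc l)) u≤4p v≤4q c a a≡256
        (subst (λ M → c * (a * (4 * suc l)) ≤ M * suc n′ * (v * v)) (sym M≡) (bound a c≤))
      where
      open Estimates (suc n′) l e 2^l≤n n<2^[1+l] lo l<2^μ
      open Estimate estimate
      open Pursuit D using (listWin⇒CopsWin)
      win : CopsWin D cops
      win = listWin⇒CopsWin cops (replicate cops zero) (length-replicate cops)
        (Pursuit.Hunt.listWin D sc K t k J q b g m cover families balls growth capacity copies flood)

    large-bounded : ∀ n → 2 ^ E ≤ n → (D : Digraph n) → StronglyConnected D → Bounded M D
    large-bounded zero h = ⊥-elim (<⇒≱ (m^n>0 2 E) h)
    large-bounded (suc n′) h D sc =
      let (l , E≤l , 2^l≤n , n<2^[1+l]) = log₂-≥ E (suc n′) h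
          (i , 11≤i , 2^i≤l , l<2^[1+i]) = log₂-≥ 11 l (≤-trans 2^11≤E E≤l)
          (e , 11+e≡i) = m≤n⇒∃[o]m+o≡n 11≤i
      in bounded n′ l e 2^l≤n n<2^[1+l] (subst (λ i → 2 ^ i ≤ l) (sym 11+e≡i) 2^i≤l)
                 (subst (λ i → l < 2 ^ suc i) (sym 11+e≡i) l<2^[1+i]) D sc

open import Data.Nat using (_≤_)
open import Data.Rational using (ℚ; 0ℚ; _<_)
open import Data.Product using (_×_; ∃-syntax)

theorem1p1 : ∃[ M ] 0ℚ < M × (∃[ n₀ ] ∀ n → n₀ ≤ n → (D : Digraph n) → StronglyConnected D →
    ∃[ c ] IsCopNumber D c ×
    fromℕ c ≤ᶜ fromℚ M *ᶜ fromℕ n *ᶜ ((log (log (fromℕ n)) ^ᶜ 2) ÷ᶜ log (fromℕ n)))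
theorem1p1 =
  -- 2621440 = 256 · 8 · 80 · 16, the first factor from the interval arithmetic and the others from
  -- `bound`. The threshold 2^(2^11) makes ⌊log₂ n⌋ at least 2^11.
  CutBounds.ι 2621440 , CutBounds.0<ι {2621440} (s≤s z≤n) ,
  (2 ^ (2 ^ 11)) , CopNumber.large-bounded (s≤s z≤n) refl refl ≤-refl
  where
  open import Data.Nat using (_^_; s≤s; z≤n)
  open import Data.Nat.Properties using (≤-refl)
  open import Data.Product using (_,_)
  open import Relation.Binary.PropositionalEquality using (refl)
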